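{- There is a constant $C$ such that for every sufficiently large $n$ there exists a $2$-planar graph of girth $5$ on $n$ vertices with at least $\left(2+\frac{2}{7}\right)n-C$ edges.
   Context: All graphs are finite and simple. A graph is $k$-planar if it admits a drawing in the plane in which every edge is crossed at most $k$ times. The girth of a graph is the length of its shortest cycle. (The paper states the edge count as $(2+\frac27)n-O(1)$.) -}

module Defs where

open import Data.Nat.Base as ℕ using (ℕ; suc)
import Data.Nat.Properties as ℕ
open import Data.Fin.Base as Fin using (Fin; zero; suc; fromℕ; inject₁)
open import Data.Rational.Base as ℚ using (ℚ; 0ℚ; 1ℚ; ½)
import Data.Rational.Properties as ℚ
open import Data.Rational.Solver using (module +-*-Solver)
open import Data.Product.Base using (Σ; ∃; _×_; _,_; proj₁; proj₂)
open import Data.Sum.Base using (_⊎_; inj₁; inj₂)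
open import Function.Definitions using (Injective)
open import Relation.Binary.PropositionalEquality using (_≡_; _≢_; refl; sym; trans; cong; subst; subst₂)
open import Relation.Nullary using (¬_)

IsCauchy : (ℕ → ℚ) → Set
IsCauchy x = ∀ ε → 0ℚ ℚ.< ε → ∃ λ N → ∀ m n → N ℕ.≤ m → N ℕ.≤ n → ℚ.∣ x m ℚ.- x n ∣ ℚ.< ε

-- Reals are Cauchy sequences of rationals; equality of reals is _≈_, not _≡_.
record ℝ : Set where
  constructor mkℝ
  field
    seq    : ℕ → ℚ
    cauchy : IsCauchy seq

open ℝ public

infix 4 _≈_ _<_ _≤_

_≈_ : ℝ → ℝ → Set
x ≈ y = ∀ ε → 0ℚ ℚ.< ε → ∃ λ N → ∀ n → N ℕ.≤ n → ℚ.∣ seq x n ℚ.- seq y n ∣ ℚ.< ε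

_<_ : ℝ → ℝ → Set
x < y = ∃ λ ε → 0ℚ ℚ.< ε × ∃ λ N → ∀ n → N ℕ.≤ n → seq x n ℚ.+ ε ℚ.< seq y n

_≤_ : ℝ → ℝ → Set
x ≤ y = ¬ (y < x)

fromℚ : ℚ → ℝ
fromℚ q = mkℝ (λ _ → q) λ ε 0<ε → 0 , λ _ _ _ _ →
  subst (ℚ._< ε) (cong ℚ.∣_∣ (sym (ℚ.+-inverseʳ q))) 0<ε

0ℝ 1ℝ : ℝ
0ℝ = fromℚ 0ℚ
1ℝ = fromℚ 1ℚ

private
  half-pos : ∀ {ε} → 0ℚ ℚ.< ε → 0ℚ ℚ.< ε ℚ.* ½
  half-pos {ε} 0<ε = subst (ℚ._< ε ℚ.* ½) (ℚ.*-zeroˡ ½) (ℚ.*-monoˡ-<-pos ½ 0<ε)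

  half+half : ∀ ε → ε ℚ.* ½ ℚ.+ ε ℚ.* ½ ≡ ε
  half+half ε = trans (sym (ℚ.*-distribˡ-+ ε ½ ½)) (ℚ.*-identityʳ ε)

  ∣-∣-sub : ∀ a b c d → ℚ.∣ (a ℚ.- b) ℚ.- (c ℚ.- d) ∣ ℚ.≤ ℚ.∣ a ℚ.- c ∣ ℚ.+ ℚ.∣ b ℚ.- d ∣
  ∣-∣-sub a b c d =
    subst (λ z → ℚ.∣ z ∣ ℚ.≤ ℚ.∣ a ℚ.- c ∣ ℚ.+ ℚ.∣ b ℚ.- d ∣)
      (solve 4 (λ a b c d → (a :- c) :- (b :- d) := (a :- b) :- (c :- d)) refl a b c d)
      (ℚ.∣p-q∣≤∣p∣+∣q∣ (a ℚ.- c) (b ℚ.- d))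
    where open +-*-Solver

  ∣-∣-lower : ∀ a b → ℚ.∣ a ∣ ℚ.- ℚ.∣ b ∣ ℚ.≤ ℚ.∣ a ℚ.- b ∣
  ∣-∣-lower a b =
    subst (ℚ.∣ a ∣ ℚ.- ℚ.∣ b ∣ ℚ.≤_)
      (solve 2 (λ u v → (u :+ v) :- v := u) refl ℚ.∣ a ℚ.- b ∣ ℚ.∣ b ∣)
      (ℚ.+-monoˡ-≤ (ℚ.- ℚ.∣ b ∣)
        (subst (λ z → ℚ.∣ z ∣ ℚ.≤ ℚ.∣ a ℚ.- b ∣ ℚ.+ ℚ.∣ b ∣)
          (solve 2 (λ a b → (a :- b) :+ b := a) refl a b)
          (ℚ.∣p+q∣≤∣p∣+∣q∣ (a ℚ.- b) b)))
    where open +-*-Solver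

  ∣-∣-swap : ∀ a b → ℚ.∣ a ℚ.- b ∣ ≡ ℚ.∣ b ℚ.- a ∣
  ∣-∣-swap a b = trans (sym (ℚ.∣-p∣≡∣p∣ (a ℚ.- b)))
    (cong ℚ.∣_∣ (solve 2 (λ a b → :- (a :- b) := b :- a) refl a b))
    where open +-*-Solver

  ∣∣-∣-lipschitz : ∀ a b → ℚ.∣ ℚ.∣ a ∣ ℚ.- ℚ.∣ b ∣ ∣ ℚ.≤ ℚ.∣ a ℚ.- b ∣
  ∣∣-∣-lipschitz a b with ℚ.∣p∣≡p∨∣p∣≡-p (ℚ.∣ a ∣ ℚ.- ℚ.∣ b ∣)
  ... | inj₁ eq = subst (ℚ._≤ ℚ.∣ a ℚ.- b ∣) (sym eq) (∣-∣-lower a b)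
  ... | inj₂ eq = subst₂ ℚ._≤_
    (sym (trans eq (solve 2 (λ u v → :- (u :- v) := v :- u) refl ℚ.∣ a ∣ ℚ.∣ b ∣)))
    (∣-∣-swap b a) (∣-∣-lower b a)
    where open +-*-Solver

infixl 6 _-_

_-_ : ℝ → ℝ → ℝ
x - y = mkℝ (λ n → seq x n ℚ.- seq y n) λ ε 0<ε →
  let N₁ , h₁ = cauchy x (ε ℚ.* ½) (half-pos 0<ε)
      N₂ , h₂ = cauchy y (ε ℚ.* ½) (half-pos 0<ε)
  in N₁ ℕ.⊔ N₂ , λ m n p q →
    ℚ.≤-<-trans (∣-∣-sub (seq x m) (seq y m) (seq x n) (seq y n))
      (subst (_ ℚ.<_) (half+half ε)
        (ℚ.+-mono-< (h₁ m n (ℕ.m⊔n≤o⇒m≤o N₁ N₂ p) (ℕ.m⊔n≤o⇒m≤o N₁ N₂ q))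
                    (h₂ m n (ℕ.m⊔n≤o⇒n≤o N₁ N₂ p) (ℕ.m⊔n≤o⇒n≤o N₁ N₂ q))))

∣_∣ : ℝ → ℝ
∣ x ∣ = mkℝ (λ n → ℚ.∣ seq x n ∣) λ ε 0<ε →
  let N , h = cauchy x ε 0<ε
  in N , λ m n p q → ℚ.≤-<-trans (∣∣-∣-lipschitz (seq x m) (seq x n)) (h m n p q)

ℝ² : Set
ℝ² = ℝ × ℝ

infix 4 _≈²_

_≈²_ : ℝ² → ℝ² → Set
(x , y) ≈² (x′ , y′) = x ≈ x′ × y ≈ y′

-- The open ball of radius r in the maximum metric, which induces the usual
-- topology of the plane.
Within : ℝ → ℝ² → ℝ² → Set
Within r (x , y) (x′ , y′) = ∣ x - x′ ∣ < r × ∣ y - y′ ∣ < r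

record I : Set where
  constructor mkI
  field
    value : ℝ
    0≤    : 0ℝ ≤ value
    ≤1    : value ≤ 1ℝ

open I public

private
  fromℚ-≤ : ∀ {p q} → p ℚ.≤ q → fromℚ p ≤ fromℚ q
  fromℚ-≤ {p} {q} p≤q (ε , 0<ε , N , h) = ℚ.<-irrefl refl
    (ℚ.<-≤-trans
      (ℚ.<-trans (subst (ℚ._< q ℚ.+ ε) (ℚ.+-identityʳ q) (ℚ.+-monoʳ-< q 0<ε)) (h N ℕ.≤-refl))
      p≤q)

  0≤1 : 0ℚ ℚ.≤ 1ℚ
  0≤1 = ℚ.nonNegative⁻¹ 1ℚ

0I 1I : I
0I = mkI 0ℝ (fromℚ-≤ ℚ.≤-refl) (fromℚ-≤ 0≤1)
1I = mkI 1ℝ (fromℚ-≤ 0≤1) (fromℚ-≤ ℚ.≤-refl)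

Interior : I → Set
Interior s = 0ℝ < value s × value s < 1ℝ

-- Continuity also makes a function compatible with _≈_: if s ≈ t then f s and
-- f t are within every ε.
Continuous : (I → ℝ²) → Set
Continuous f = ∀ s ε → 0ℚ ℚ.< ε → ∃ λ δ → 0ℚ ℚ.< δ ×
  (∀ t → ∣ value s - value t ∣ < fromℚ δ → Within (fromℚ ε) (f s) (f t))

record Arc : Set where
  field
    at         : I → ℝ²
    continuous : Continuous at
    injective  : ∀ s t → at s ≈² at t → value s ≈ value t

open Arc public using (at)

-- An edge is a two-element set of vertices, listed in increasing order, so
-- there are no loops, and injectivity of ends excludes parallel edges.
record Graph (n : ℕ) : Set where
  field
    size           : ℕ
    ends           : Fin size → Fin n × Fin n
    ends-ordered   : ∀ e → proj₁ (ends e) Fin.< proj₂ (ends e)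
    ends-injective : Injective _≡_ _≡_ ends

  Edge : Set
  Edge = Fin size

  Adjacent : Fin n → Fin n → Set
  Adjacent u v = ∃ λ e → ends e ≡ (u , v) ⊎ ends e ≡ (v , u)

module _ {n : ℕ} (G : Graph n) where
  open Graph G

  record Cycle : Set where
    field
      last     : ℕ
      vertex   : Fin (suc last) → Fin n
      distinct : Injective _≡_ _≡_ vertex
      step     : ∀ (i : Fin last) → Adjacent (vertex (inject₁ i)) (vertex (suc i))
      close    : Adjacent (vertex (fromℕ last)) (vertex zero)
      3≤length : 3 ℕ.≤ suc last

    length : ℕ
    length = suc last

  HasGirth : ℕ → Set
  HasGirth g = (∃ λ (c : Cycle) → Cycle.length c ≡ g) × (∀ (c : Cycle) → g ℕ.≤ Cycle.length c)

  record Drawing : Set where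
    field
      point           : Fin n → ℝ²
      point-injective : ∀ u v → point u ≈² point v → u ≡ v
      arc             : Edge → Arc
      arc-start       : ∀ e → at (arc e) 0I ≈² point (proj₁ (ends e))
      arc-end         : ∀ e → at (arc e) 1I ≈² point (proj₂ (ends e))
      avoids-vertices : ∀ e s → Interior s → ∀ v → ¬ (at (arc e) s ≈² point v)

    -- A crossing on e is a common interior point of e and another edge f.
    -- Several edges meeting e at one point give several crossings, and a
    -- point where two edges merely touch counts as well.
    record Crossing (e : Edge) : Set where
      field
        other          : Edge
        other≢         : other ≢ e
        param          : I
        param-interior : Interior param
        otherParam     : I
        other-interior : Interior otherParam
        meet           : at (arc e) param ≈² at (arc other) otherParam

    SameCrossing : ∀ {e} → Crossing e → Crossing e → Set
    SameCrossing c d = Crossing.other c ≡ Crossing.other d × value (Crossing.param c) ≈ value (Crossing.param d)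

    CrossedAtMost : ℕ → Edge → Set
    CrossedAtMost k e = ∀ m (c : Fin m → Crossing e) → Injective _≡_ SameCrossing c → m ℕ.≤ k

  KPlanar : ℕ → Set
  KPlanar k = Σ Drawing λ D → ∀ e → Drawing.CrossedAtMost D k e

{-# OPTIONS --safe #-}
-- Disjoint copies of a single finite graph suffice: there is a straight-line
-- drawing on 63 points with 144 = (16/7)·63 edges, girth 5 and at most two
-- crossings per edge.  Its points have integer coordinates and distinct
-- abscissae, so translated copies can be placed side by side and the vertices
-- numbered from left to right.  Two segments do not meet in their interiors
-- when a line weakly separates them without containing both; the candidates
-- are the lines spanned by the two segments and the vertical lines, so that
-- everything about the one finite drawing is a decidable statement on integers.
module Submission where

open import Defs using (Graph; KPlanar; HasGirth)
open import Data.Nat.Base using (ℕ; _≥_)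
open import Data.Integer.Base using (+_)
open import Data.Rational.Base using (ℚ; _/_; _+_; _*_; _-_; _≤_)
open import Data.Product.Base using (∃; _×_)

open import Defs using (ℝ; ℝ²; mkℝ; seq; cauchy; _≈_; _≈²_; fromℚ; I; value; 0I; 1I; Interior; Arc; Drawing; Cycle)
import Algebra.Properties.AbelianGroup as AbelianGroup
open import Data.Fin.Base as Fin using (Fin; toℕ; fromℕ; fromℕ<; inject₁; remQuot; combine)
import Data.Fin.Properties as Fin
open import Data.Integer.Base as ℤ using (ℤ; -[1+_])
import Data.Integer.Properties as ℤ
import Data.Integer.Solver as ℤ
open import Data.List.Base using (List; []; _∷_; _++_; map; filter; length; lookup)
open import Data.List.Membership.Propositional using (_∈_; _∉_)
open import Data.List.Membership.Propositional.Properties using (∈-lookup; ∈-filter⁺; ∈-filter⁻; ∈-map⁺; ∈-map⁻; ∈-++⁺ˡ; ∈-++⁺ʳ; ∈-++⁻)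
open import Data.List.Membership.Setoid.Properties using (index-injective)
open import Data.List.Relation.Unary.All as All using (All)
open import Data.List.Relation.Unary.AllPairs using (_∷_)
open import Data.List.Relation.Unary.Any using (index)
open import Data.List.Relation.Unary.Any.Properties using (lookup-index)
open import Data.List.Relation.Unary.Unique.Propositional using (Unique)
open import Data.Nat.Base as ℕ using (zero; suc; NonZero; s≤s; z≤n)
import Data.Nat.Divisibility as ℕ
import Data.Nat.DivMod as ℕ
import Data.Nat.Properties as ℕ
open import Data.List.Membership.DecPropositional ℕ._≟_ using (_∈?_)
open import Data.Product.Base using (_,_; proj₁; proj₂)
open import Data.Product.Properties using (≡-dec)
open import Data.Rational.Base using (_<_; -_; ∣_∣; 0ℚ; 1ℚ; ½; _⊓_; 1/_; toℚᵘ; Positive; positive; nonNegative; ≢-nonZero)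
import Data.Rational.Properties as ℚ
import Data.Rational.Solver as ℚ
import Data.Rational.Unnormalised.Base as ℚᵘ
import Data.Rational.Unnormalised.Properties as ℚᵘ
open import Data.Sum.Base as Sum using (_⊎_; inj₁; inj₂)
open import Function.Base using (_∘_)
open import Function.Definitions using (Injective)
open import Relation.Binary.Definitions using (tri<; tri≈; tri>)
open import Relation.Binary.PropositionalEquality using (_≡_; _≢_; refl; sym; trans; cong; cong₂; subst; subst₂; module ≡-Reasoning; setoid)
open import Relation.Nullary using (¬_; contradiction; Dec; yes; no; ¬?; _×-dec_; _⊎-dec_; _→-dec_)
open import Relation.Nullary.Decidable using (from-yes)

-- Null sequences of rationals

-- The obstacle is that the order of Cauchy reals is undecidable, so no case distinction can be made
-- on where a hypothetical meeting point lies. Separation is therefore made quantitative. A strict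
-- inequality of reals carries a rational margin, so an interior parameter stays away from 0 and 1
-- by a fixed rational; this turns weak integer inequalities between endpoints into a positive gap
-- between the values of a linear form on the two segments, whereas a meeting would make the
-- difference of these values tend to zero. Only an upper bound on crossings is wanted, so it is
-- never shown that two edges do cross. It suffices that few pairs escape the separation tests and
-- that the segments of an escaping pair are not parallel, hence meet at most once. Crossings are
-- counted by the other edge, so several edges through one point do no harm. The vertices beyond the
-- last complete copy cost at most the edges of one block, which the additive constant absorbs.

Null : (ℕ → ℚ) → Set
Null u = ∀ ε → 0ℚ < ε → ∃ λ N → ∀ n → N ℕ.≤ n → ∣ u n ∣ < ε

null-cong : ∀ {u v} → (∀ n → u n ≡ v n) → Null u → Null v
null-cong u≗v u→0 ε 0<ε =
  let N , h = u→0 ε 0<ε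
  in N , λ n N≤n → subst (λ z → ∣ z ∣ < ε) (u≗v n) (h n N≤n)

0<ε*½ : ∀ {ε} → 0ℚ < ε → 0ℚ < ε * ½
0<ε*½ {ε} 0<ε = subst (_< ε * ½) (ℚ.*-zeroˡ ½) (ℚ.*-monoˡ-<-pos ½ 0<ε)

ε*½+ε*½≡ε : ∀ ε → ε * ½ + ε * ½ ≡ ε
ε*½+ε*½≡ε ε = trans (sym (ℚ.*-distribˡ-+ ε ½ ½)) (ℚ.*-identityʳ ε)

p<p+ε : ∀ p {ε} → 0ℚ < ε → p < p + ε
p<p+ε p {ε} 0<ε = subst (_< p + ε) (ℚ.+-identityʳ p) (ℚ.+-monoʳ-< p 0<ε)

null-+ : ∀ {u v} → Null u → Null v → Null (λ n → u n + v n)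
null-+ {u} {v} u→0 v→0 ε 0<ε =
  let M , hu = u→0 (ε * ½) (0<ε*½ 0<ε)
      N , hv = v→0 (ε * ½) (0<ε*½ 0<ε)
  in M ℕ.⊔ N , λ n M⊔N≤n →
    ℚ.≤-<-trans (ℚ.∣p+q∣≤∣p∣+∣q∣ (u n) (v n))
      (subst (_ <_) (ε*½+ε*½≡ε ε)
        (ℚ.+-mono-< (hu n (ℕ.m⊔n≤o⇒m≤o M N M⊔N≤n)) (hv n (ℕ.m⊔n≤o⇒n≤o M N M⊔N≤n))))

bound : ℚ → ℚ
bound c = 1ℚ + ∣ c ∣

0<bound : ∀ c → 0ℚ < bound c
0<bound c = ℚ.<-≤-trans (ℚ.positive⁻¹ 1ℚ)
  (subst (_≤ bound c) (ℚ.+-identityʳ 1ℚ) (ℚ.+-monoʳ-≤ 1ℚ (ℚ.0≤∣p∣ c)))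

-- δ = ε / (1 + ∣ c ∣), so that c = 0 needs no special treatment.
shrink : ∀ c ε → 0ℚ < ε → ∃ λ δ → 0ℚ < δ × (∀ x → ∣ x ∣ < δ → ∣ c * x ∣ < ε)
shrink c ε 0<ε = δ , 0<δ , λ x ∣x∣<δ → begin-strict
  ∣ c * x ∣         ≡⟨ ℚ.∣p*q∣≡∣p∣*∣q∣ c x ⟩
  ∣ c ∣ * ∣ x ∣     ≤⟨ ℚ.*-monoʳ-≤-nonNeg ∣ x ∣ {{ℚ.∣-∣-nonNeg x}} c≤b ⟩
  bound c * ∣ x ∣   <⟨ ℚ.*-monoʳ-<-pos (bound c) ∣x∣<δ ⟩
  bound c * δ       ≡⟨ b*δ≡ε ⟩
  ε ∎
  where
  open ℚ.≤-Reasoning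
  instance
    b-pos : Positive (bound c)
    b-pos = positive (0<bound c)
    b≢0 = ℚ.pos⇒nonZero (bound c)
    1/b-pos = ℚ.1/pos⇒pos (bound c)
  δ = ε * 1/ bound c
  0<δ : 0ℚ < δ
  0<δ = subst (_< δ) (ℚ.*-zeroˡ (1/ bound c)) (ℚ.*-monoˡ-<-pos (1/ bound c) 0<ε)
  b*δ≡ε : bound c * δ ≡ ε
  b*δ≡ε = trans (ℚ.*-comm (bound c) δ) (trans (ℚ.*-assoc ε (1/ bound c) (bound c))
    (trans (cong (ε *_) (ℚ.*-inverseˡ (bound c))) (ℚ.*-identityʳ ε)))
  c≤b : ∣ c ∣ ≤ bound c
  c≤b = subst (_≤ bound c) (ℚ.+-identityˡ ∣ c ∣) (ℚ.+-monoˡ-≤ ∣ c ∣ (ℚ.nonNegative⁻¹ 1ℚ))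

null-* : ∀ c {u} → Null u → Null (λ n → c * u n)
null-* c {u} u→0 ε 0<ε =
  let δ , 0<δ , h = shrink c ε 0<ε
      N , k = u→0 δ 0<δ
  in N , λ n N≤n → h (u n) (k n N≤n)

null-cancel : ∀ {c} → c ≢ 0ℚ → ∀ {u} → Null (λ n → c * u n) → Null u
null-cancel {c} c≢0 {u} cu→0 = null-cong eq (null-* (1/ c) cu→0)
  where
  instance c-nonZero = ≢-nonZero c≢0
  eq : ∀ n → 1/ c * (c * u n) ≡ u n
  eq n = trans (sym (ℚ.*-assoc (1/ c) c (u n)))
    (trans (cong (_* u n) (ℚ.*-inverseˡ c)) (ℚ.*-identityˡ (u n)))

-- Affine interpolation

mix : ℚ → ℚ → ℚ → ℚ
mix p q s = p + (q - p) * s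

mix-∸ : ∀ p q s t → mix p q s - mix p q t ≡ (q - p) * (s - t)
mix-∸ = solve 4 (λ p q s t → (p :+ (q :- p) :* s) :- (p :+ (q :- p) :* t) := (q :- p) :* (s :- t)) refl
  where open ℚ.+-*-Solver

mix-close : ∀ p q ε → 0ℚ < ε → ∃ λ δ → 0ℚ < δ × (∀ s t → ∣ s - t ∣ < δ → ∣ mix p q s - mix p q t ∣ < ε)
mix-close p q ε 0<ε =
  let δ , 0<δ , h = shrink (q - p) ε 0<ε
  in δ , 0<δ , λ s t close → subst (λ z → ∣ z ∣ < ε) (sym (mix-∸ p q s t)) (h (s - t) close)

mixℝ : ℚ → ℚ → ℝ → ℝ
mixℝ p q x = mkℝ (λ n → mix p q (seq x n)) λ ε 0<ε →
  let δ , 0<δ , h = mix-close p q ε 0<ε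
      N , k = cauchy x δ 0<δ
  in N , λ m n N≤m N≤n → h _ _ (k m n N≤m N≤n)

mixℝ-continuous : ∀ p q (x : ℝ) ε → 0ℚ < ε → ∃ λ δ → 0ℚ < δ ×
  (∀ y → Defs.∣ x Defs.- y ∣ Defs.< fromℚ δ → Defs.∣ mixℝ p q x Defs.- mixℝ p q y ∣ Defs.< fromℚ ε)
mixℝ-continuous p q x ε 0<ε =
  -- Strict inequality of reals asks for a rational margin besides the bound; half of `ε` is kept
  -- back for it.
  let δ , 0<δ , h = mix-close p q (ε * ½) (0<ε*½ 0<ε)
  in δ , 0<δ , λ { y (η , 0<η , N , k) →
    ε * ½ , 0<ε*½ 0<ε , N , λ n N≤n →
      subst (∣ mix p q (seq x n) - mix p q (seq y n) ∣ + ε * ½ <_) (ε*½+ε*½≡ε ε)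
        (ℚ.+-monoˡ-< (ε * ½) (h (seq x n) (seq y n)
          (ℚ.<-trans (p<p+ε ∣ seq x n - seq y n ∣ 0<η) (k n N≤n)))) }

-- Points with integer coordinates

ι : ℤ → ℚ
ι z = z / 1

-- The fraction `z / 1` is reduced through a gcd, which does not compute for a variable `z`. The
-- unnormalised rationals avoid the gcd, so the arithmetic of `ι` is derived there.
toℚᵘ-ι : ∀ z → toℚᵘ (ι z) ℚᵘ.≃ z ℚᵘ./ 1
toℚᵘ-ι z = ℚ.toℚᵘ-fromℚᵘ (z ℚᵘ./ 1)

ι-+ : ∀ x y → ι (x ℤ.+ y) ≡ ι x + ι y
ι-+ x y = ℚ.toℚᵘ-injective (begin-equality
  toℚᵘ (ι (x ℤ.+ y))             ≃⟨ toℚᵘ-ι (x ℤ.+ y) ⟩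
  (x ℤ.+ y) ℚᵘ./ 1               ≃⟨ ℚᵘ.*≡* (solve 2 (λ a b →
    (a :+ b) :* con (+ 1) := (a :* con (+ 1) :+ b :* con (+ 1)) :* con (+ 1)) refl x y) ⟩
  (x ℚᵘ./ 1) ℚᵘ.+ (y ℚᵘ./ 1)     ≃⟨ ℚᵘ.+-cong (toℚᵘ-ι x) (toℚᵘ-ι y) ⟨
  toℚᵘ (ι x) ℚᵘ.+ toℚᵘ (ι y)     ≃⟨ ℚ.toℚᵘ-homo-+ (ι x) (ι y) ⟨
  toℚᵘ (ι x + ι y)               ∎)
  where open ℚᵘ.≤-Reasoning ; open ℤ.+-*-Solver

ι-* : ∀ x y → ι (x ℤ.* y) ≡ ι x * ι y
ι-* x y = ℚ.toℚᵘ-injective (begin-equality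
  toℚᵘ (ι (x ℤ.* y))             ≃⟨ toℚᵘ-ι (x ℤ.* y) ⟩
  (x ℤ.* y) ℚᵘ./ 1               ≃⟨ ℚᵘ.*≡* refl ⟩
  (x ℚᵘ./ 1) ℚᵘ.* (y ℚᵘ./ 1)     ≃⟨ ℚᵘ.*-cong (toℚᵘ-ι x) (toℚᵘ-ι y) ⟨
  toℚᵘ (ι x) ℚᵘ.* toℚᵘ (ι y)     ≃⟨ ℚ.toℚᵘ-homo-* (ι x) (ι y) ⟨
  toℚᵘ (ι x * ι y)               ∎)
  where open ℚᵘ.≤-Reasoning

ι-mono-≤ : ∀ {x y} → x ℤ.≤ y → ι x ≤ ι y
ι-mono-≤ {x} {y} x≤y = ℚ.toℚᵘ-cancel-≤ (begin
  toℚᵘ (ι x)   ≃⟨ toℚᵘ-ι x ⟩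
  x ℚᵘ./ 1     ≤⟨ ℚᵘ.*≤* (ℤ.*-monoʳ-≤-nonNeg (+ 1) x≤y) ⟩
  y ℚᵘ./ 1     ≃⟨ toℚᵘ-ι y ⟨
  toℚᵘ (ι y)   ∎)
  where open ℚᵘ.≤-Reasoning

ι-mono-< : ∀ {x y} → x ℤ.< y → ι x < ι y
ι-mono-< {x} {y} x<y = ℚ.toℚᵘ-cancel-< (begin-strict
  toℚᵘ (ι x)   ≃⟨ toℚᵘ-ι x ⟩
  x ℚᵘ./ 1     <⟨ ℚᵘ.*<* (ℤ.*-monoʳ-<-pos (+ 1) x<y) ⟩
  y ℚᵘ./ 1     ≃⟨ toℚᵘ-ι y ⟨
  toℚᵘ (ι y)   ∎)
  where open ℚᵘ.≤-Reasoning

ι-injective : ∀ {x y} → ι x ≡ ι y → x ≡ y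
ι-injective {x} {y} eq with ℤ.<-cmp x y
... | tri< x<y _ _ = contradiction eq (ℚ.<⇒≢ (ι-mono-< x<y))
... | tri≈ _ x≡y _ = x≡y
... | tri> _ _ y<x = contradiction (sym eq) (ℚ.<⇒≢ (ι-mono-< y<x))

Point : Set
Point = ℤ × ℤ

⟨_,_⟩ : Point → Point → ℤ
⟨ (a , b) , (x , y) ⟩ = a ℤ.* x ℤ.+ b ℤ.* y

Segment : Set
Segment = Point × Point

alongAt : Segment → I → ℝ²
alongAt ((px , py) , (qx , qy)) s = mixℝ (ι px) (ι qx) (value s) , mixℝ (ι py) (ι qy) (value s)

-- A linear form commutes with affine interpolation, so its values along a segment are determined by
-- two integers, its values at the endpoints. The agreement with the coordinates is `along-⟨⟩`.
along : Segment → Point → I → ℕ → ℚ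
along (P , Q) φ s n = mix (ι ⟨ φ , P ⟩) (ι ⟨ φ , Q ⟩) (seq (value s) n)

mix-linear : ∀ a b p p′ q q′ s → a * mix p q s + b * mix p′ q′ s ≡ mix (a * p + b * p′) (a * q + b * q′) s
mix-linear = solve 7 (λ a b p p′ q q′ s →
  a :* (p :+ (q :- p) :* s) :+ b :* (p′ :+ (q′ :- p′) :* s) :=
  (a :* p :+ b :* p′) :+ ((a :* q :+ b :* q′) :- (a :* p :+ b :* p′)) :* s) refl
  where open ℚ.+-*-Solver

ι-⟨⟩ : ∀ a b x y → ι ⟨ (a , b) , (x , y) ⟩ ≡ ι a * ι x + ι b * ι y
ι-⟨⟩ a b x y = trans (ι-+ (a ℤ.* x) (b ℤ.* y)) (cong₂ _+_ (ι-* a x) (ι-* b y))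

along-⟨⟩ : ∀ e φ s n → along e φ s n ≡
  ι (proj₁ φ) * seq (proj₁ (alongAt e s)) n + ι (proj₂ φ) * seq (proj₂ (alongAt e s)) n
along-⟨⟩ ((px , py) , (qx , qy)) (a , b) s n = begin
  mix (ι ⟨ (a , b) , (px , py) ⟩) (ι ⟨ (a , b) , (qx , qy) ⟩) sₙ
    ≡⟨ cong₂ (λ x y → mix x y sₙ) (ι-⟨⟩ a b px py) (ι-⟨⟩ a b qx qy) ⟩
  mix (ι a * ι px + ι b * ι py) (ι a * ι qx + ι b * ι qy) sₙ
    ≡⟨ mix-linear (ι a) (ι b) (ι px) (ι py) (ι qx) (ι qy) sₙ ⟨
  ι a * mix (ι px) (ι qx) sₙ + ι b * mix (ι py) (ι qy) sₙ ∎
  where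
  open ≡-Reasoning
  sₙ = seq (value s) n

-- A linear form turns a meeting in the plane into a single null sequence of rationals, and the
-- direction `φ` remains free to be chosen.
meet⇒null : ∀ e f s t → alongAt e s ≈² alongAt f t → ∀ φ → Null (λ n → along e φ s n - along f φ t n)
meet⇒null e f s t (x≈ , y≈) φ@(a , b) =
  null-cong eq (null-+ (null-* (ι a) x≈) (null-* (ι b) y≈))
  where
  x = seq (proj₁ (alongAt e s))
  y = seq (proj₂ (alongAt e s))
  x′ = seq (proj₁ (alongAt f t))
  y′ = seq (proj₂ (alongAt f t))
  eq : ∀ n → ι a * (x n - x′ n) + ι b * (y n - y′ n) ≡ along e φ s n - along f φ t n
  eq n = trans
    (solve 6 (λ a b x y x′ y′ → a :* (x :- x′) :+ b :* (y :- y′) := (a :* x :+ b :* y) :- (a :* x′ :+ b :* y′))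
      refl (ι a) (ι b) (x n) (y n) (x′ n) (y′ n))
    (sym (cong₂ _-_ (along-⟨⟩ e φ s n) (along-⟨⟩ f φ t n)))
    where open ℚ.+-*-Solver

-- Separation of segments by a line

⊓-glb-< : ∀ {p q r} → r < p → r < q → r < p ⊓ q
⊓-glb-< {p} {q} {r} r<p r<q with ℚ.⊓-sel p q
... | inj₁ eq = subst (r <_) (sym eq) r<p
... | inj₂ eq = subst (r <_) (sym eq) r<q

p≤q⇒0≤q-p : ∀ {p q} → p ≤ q → 0ℚ ≤ q - p
p≤q⇒0≤q-p {p} {q} p≤q = subst (_≤ q - p) (ℚ.+-inverseʳ p) (ℚ.+-monoˡ-≤ (- p) p≤q)

-- The two strict inequalities in `Interior` each contain a rational margin; the smaller one serves
-- at both ends.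
interior-bound : ∀ s → Interior s → ∃ λ ε → 0ℚ < ε × ∃ λ N → ∀ n → N ℕ.≤ n →
  ε ≤ seq (value s) n × ε ≤ 1ℚ - seq (value s) n
interior-bound s ((ε , 0<ε , M , h) , (η , 0<η , N , k)) =
  ε ⊓ η , ⊓-glb-< 0<ε 0<η , M ℕ.⊔ N , λ n le →
    ℚ.≤-trans (ℚ.p⊓q≤p ε η) (ℚ.<⇒≤ (subst (_< seq (value s) n) (ℚ.+-identityˡ ε) (h n (ℕ.m⊔n≤o⇒m≤o M N le)))) ,
    ℚ.≤-trans (ℚ.p⊓q≤q ε η) (subst (_≤ 1ℚ - seq (value s) n)
      (solve 2 (λ s η → (s :+ η) :- s := η) refl (seq (value s) n) η)
      (ℚ.+-monoˡ-≤ (- seq (value s) n) (ℚ.<⇒≤ (k n (ℕ.m⊔n≤o⇒n≤o M N le)))))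
  where open ℚ.+-*-Solver

-- The interpolation is the convex combination with weights `1 - s` and `s`, and both weights are at
-- least `ε`.
mix-lower : ∀ {p q ε s} → 0ℚ ≤ p → 0ℚ ≤ q → ε ≤ s → ε ≤ 1ℚ - s → ε * (p + q) ≤ mix p q s
mix-lower {p} {q} {ε} {s} 0≤p 0≤q ε≤s ε≤1-s = begin
  ε * (p + q)              ≡⟨ ℚ.*-distribˡ-+ ε p q ⟩
  ε * p + ε * q            ≤⟨ ℚ.+-mono-≤ (ℚ.*-monoʳ-≤-nonNeg p {{nonNegative 0≤p}} ε≤1-s)
                                          (ℚ.*-monoʳ-≤-nonNeg q {{nonNegative 0≤q}} ε≤s) ⟩
  (1ℚ - s) * p + s * q     ≡⟨ solve 3 (λ p q s → (con 1ℚ :- s) :* p :+ s :* q := p :+ (q :- p) :* s) refl p q s ⟩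
  mix p q s                ∎
  where open ℚ.≤-Reasoning ; open ℚ.+-*-Solver

-- The inequalities against `c` are weak because edges may share an endpoint, and because the line
-- may contain one of the segments. Given them, the strict inequality of sums says exactly that the
-- four endpoints do not all lie on the line.
Separates : Point → ℤ → Segment → Segment → Set
Separates φ c (P , Q) (R , S) =
  ⟨ φ , P ⟩ ℤ.≤ c × ⟨ φ , Q ⟩ ℤ.≤ c × c ℤ.≤ ⟨ φ , R ⟩ × c ℤ.≤ ⟨ φ , S ⟩ ×
  ⟨ φ , P ⟩ ℤ.+ ⟨ φ , Q ⟩ ℤ.< ⟨ φ , R ⟩ ℤ.+ ⟨ φ , S ⟩

-- Once both parameters lie between `θ` and `1 - θ`, the values of `φ` on the two segments differ by
-- at least `θ` times the gap between the sums of endpoint values. A meeting would bring them closer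
-- than that.
separated⇒¬meet : ∀ φ c e f → Separates φ c e f →
  ∀ s t → Interior s → Interior t → ¬ (alongAt e s ≈² alongAt f t)
separated⇒¬meet φ c e@(P , Q) f@(R , S) (p≤c , q≤c , c≤r , c≤u , p+q<r+u) s t s-int t-int meet =
  ℚ.<-irrefl refl (begin-strict
    θ * (C + D - (A + B))
      -- The gap is split at the level `γ` of the line, which leaves for each segment a sum of two
      -- nonnegative distances, as `mix-lower` requires.
      ≡⟨ solve 6 (λ θ A B C D γ → θ :* ((C :+ D) :- (A :+ B)) :=
           θ :* ((γ :- A) :+ (γ :- B)) :+ θ :* ((C :- γ) :+ (D :- γ))) refl θ A B C D γ ⟩
    θ * ((γ - A) + (γ - B)) + θ * ((C - γ) + (D - γ))
      ≤⟨ ℚ.+-mono-≤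
           (mix-lower (p≤q⇒0≤q-p (ι-mono-≤ p≤c)) (p≤q⇒0≤q-p (ι-mono-≤ q≤c))
             (ℚ.≤-trans (ℚ.p⊓q≤p ε η) (proj₁ (hs k ks))) (ℚ.≤-trans (ℚ.p⊓q≤p ε η) (proj₂ (hs k ks))))
           (mix-lower (p≤q⇒0≤q-p (ι-mono-≤ c≤r)) (p≤q⇒0≤q-p (ι-mono-≤ c≤u))
             (ℚ.≤-trans (ℚ.p⊓q≤q ε η) (proj₁ (ht k kt))) (ℚ.≤-trans (ℚ.p⊓q≤q ε η) (proj₂ (ht k kt)))) ⟩
    mix (γ - A) (γ - B) sₖ + mix (C - γ) (D - γ) tₖ
      ≡⟨ solve 7 (λ A B C D γ s t →
           ((γ :- A) :+ ((γ :- B) :- (γ :- A)) :* s) :+ ((C :- γ) :+ ((D :- γ) :- (C :- γ)) :* t) :=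
           :- ((A :+ (B :- A) :* s) :- (C :+ (D :- C) :* t))) refl A B C D γ sₖ tₖ ⟩
    - (mix A B sₖ - mix C D tₖ)        ≤⟨ p≤∣p∣ (- (mix A B sₖ - mix C D tₖ)) ⟩
    ∣ - (mix A B sₖ - mix C D tₖ) ∣    ≡⟨ ℚ.∣-p∣≡∣p∣ (mix A B sₖ - mix C D tₖ) ⟩
    ∣ mix A B sₖ - mix C D tₖ ∣        <⟨ hm k km ⟩
    θ * (C + D - (A + B))              ∎)
  where
  open ℚ.≤-Reasoning
  open ℚ.+-*-Solver
  p≤∣p∣ : ∀ p → p ≤ ∣ p ∣
  p≤∣p∣ p with ℚ.≤-total 0ℚ p
  ... | inj₁ 0≤p = ℚ.≤-reflexive (sym (ℚ.0≤p⇒∣p∣≡p 0≤p))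
  ... | inj₂ p≤0 = ℚ.≤-trans p≤0 (ℚ.0≤∣p∣ p)
  A = ι ⟨ φ , P ⟩
  B = ι ⟨ φ , Q ⟩
  C = ι ⟨ φ , R ⟩
  D = ι ⟨ φ , S ⟩
  γ = ι c
  εs = interior-bound s s-int
  εt = interior-bound t t-int
  ε = proj₁ εs
  η = proj₁ εt
  θ = ε ⊓ η
  0<θ : 0ℚ < θ
  0<θ = ⊓-glb-< (proj₁ (proj₂ εs)) (proj₁ (proj₂ εt))
  A+B<C+D : A + B < C + D
  A+B<C+D = subst₂ _<_ (ι-+ ⟨ φ , P ⟩ ⟨ φ , Q ⟩) (ι-+ ⟨ φ , R ⟩ ⟨ φ , S ⟩) (ι-mono-< p+q<r+u)
  gap : 0ℚ < C + D - (A + B)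
  gap = subst (_< C + D - (A + B)) (ℚ.+-inverseʳ (A + B)) (ℚ.+-monoˡ-< (- (A + B)) A+B<C+D)
  0<θ*gap : 0ℚ < θ * (C + D - (A + B))
  0<θ*gap = subst (_< θ * (C + D - (A + B))) (ℚ.*-zeroʳ θ) (ℚ.*-monoʳ-<-pos θ {{positive 0<θ}} gap)
  null = meet⇒null e f s t meet φ (θ * (C + D - (A + B))) 0<θ*gap
  Ns = proj₁ (proj₂ (proj₂ εs))
  hs = proj₂ (proj₂ (proj₂ εs))
  Nt = proj₁ (proj₂ (proj₂ εt))
  ht = proj₂ (proj₂ (proj₂ εt))
  hm = proj₂ null
  -- One index late enough for both margins and for the null sequence already yields the
  -- contradiction.
  k = Ns ℕ.⊔ Nt ℕ.⊔ proj₁ null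
  ks = ℕ.≤-trans (ℕ.m≤m⊔n Ns Nt) (ℕ.m≤m⊔n (Ns ℕ.⊔ Nt) (proj₁ null))
  kt = ℕ.≤-trans (ℕ.m≤n⊔m Ns Nt) (ℕ.m≤m⊔n (Ns ℕ.⊔ Nt) (proj₁ null))
  km = ℕ.m≤n⊔m (Ns ℕ.⊔ Nt) (proj₁ null)
  sₖ = seq (value s) k
  tₖ = seq (value t) k

-- Equality of reals and recovery of interpolation parameters

null-const⇒≡0 : ∀ {c} → Null (λ _ → c) → c ≡ 0ℚ
null-const⇒≡0 {c} c→0 with ℚ.<-cmp 0ℚ ∣ c ∣
... | tri≈ _ 0≡∣c∣ _ = ℚ.∣p∣≡0⇒p≡0 c (sym 0≡∣c∣)
... | tri> _ _ ∣c∣<0 = contradiction (ℚ.≤-<-trans (ℚ.0≤∣p∣ c) ∣c∣<0) (ℚ.<-irrefl refl)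
... | tri< 0<∣c∣ _ _ =
  let N , small = c→0 ∣ c ∣ 0<∣c∣
  in contradiction (small N ℕ.≤-refl) (ℚ.<-irrefl refl)

null-0 : ∀ {u} → (∀ n → u n ≡ 0ℚ) → Null u
null-0 u≡0 ε 0<ε = 0 , λ n _ → subst (λ z → ∣ z ∣ < ε) (sym (u≡0 n)) 0<ε

≡⇒≈ : ∀ x y → (∀ n → seq x n ≡ seq y n) → x ≈ y
≡⇒≈ x y eq = null-0 λ n → trans (cong (_- seq y n) (eq n)) (ℚ.+-inverseʳ (seq y n))

≈-sym : ∀ x y → x ≈ y → y ≈ x
≈-sym x y x≈y = null-cong (λ n → solve 2 (λ x y → con (- 1ℚ) :* (x :- y) := y :- x) refl (seq x n) (seq y n))
  (null-* (- 1ℚ) x≈y)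
  where open ℚ.+-*-Solver

≈²-sym : ∀ p q → p ≈² q → q ≈² p
≈²-sym (x , y) (x′ , y′) (x≈ , y≈) = ≈-sym x x′ x≈ , ≈-sym y y′ y≈

mix-constant : ∀ p s → mix p p s ≡ p
mix-constant = solve 2 (λ p s → p :+ (p :- p) :* s := p) refl
  where open ℚ.+-*-Solver

p≢q⇒q-p≢0 : ∀ {p q} → p ≢ q → q - p ≢ 0ℚ
p≢q⇒q-p≢0 {p} {q} p≢q q-p≡0 = p≢q (begin
  p               ≡⟨ ℚ.+-identityˡ p ⟨
  0ℚ + p          ≡⟨ cong (_+ p) q-p≡0 ⟨
  (q - p) + p     ≡⟨ solve 2 (λ p q → (q :- p) :+ p := q) refl p q ⟩
  q               ∎)
  where open ≡-Reasoning ; open ℚ.+-*-Solver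

mix-injective : ∀ {p q} → p ≢ q → ∀ (u v : ℕ → ℚ) → Null (λ n → mix p q (u n) - mix p q (v n)) → Null (λ n → u n - v n)
mix-injective {p} {q} p≢q u v = null-cancel (p≢q⇒q-p≢0 p≢q) ∘ null-cong (λ n → mix-∸ p q (u n) (v n))

-- Straight drawings of segments

-- Since the abscissa strictly increases along the segment, the first coordinate alone recovers the
-- parameter.
segmentArc : ∀ (e : Segment) → proj₁ (proj₁ e) ℤ.< proj₁ (proj₂ e) → Arc
segmentArc e@((px , py) , (qx , qy)) px<qx = record
  { at         = alongAt e
  ; continuous = λ s ε 0<ε →
      let δ , 0<δ , h = mixℝ-continuous (ι px) (ι qx) (value s) ε 0<ε
          η , 0<η , k = mixℝ-continuous (ι py) (ι qy) (value s) ε 0<ε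
      in δ ⊓ η , ⊓-glb-< 0<δ 0<η , λ t close →
        h (value t) (weaken Defs.∣ value s Defs.- value t ∣ (ℚ.p⊓q≤p δ η) close) ,
        k (value t) (weaken Defs.∣ value s Defs.- value t ∣ (ℚ.p⊓q≤q δ η) close)
  ; injective  = λ s t (x≈ , _) → mix-injective (ℚ.<⇒≢ (ι-mono-< px<qx)) (seq (value s)) (seq (value t)) x≈
  }
  where
  weaken : ∀ x {p q} → p ≤ q → x Defs.< fromℚ p → x Defs.< fromℚ q
  weaken x p≤q (ε , 0<ε , N , h) = ε , 0<ε , N , λ n N≤n → ℚ.<-≤-trans (h n N≤n) p≤q

place : Point → ℝ²
place (x , y) = fromℚ (ι x) , fromℚ (ι y)

place-injective : ∀ P Q → place P ≈² place Q → P ≡ Q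
place-injective P Q (x≈ , y≈) = cong₂ _,_ (coordinate x≈) (coordinate y≈)
  where
  coordinate : ∀ {x y} → fromℚ (ι x) ≈ fromℚ (ι y) → x ≡ y
  coordinate {x} {y} x≈y with ι y ℚ.≟ ι x
  ... | yes eq = ι-injective (sym eq)
  ... | no neq = contradiction (null-const⇒≡0 x≈y) (p≢q⇒q-p≢0 neq)

alongAt-0 : ∀ P Q → alongAt (P , Q) 0I ≈² place P
alongAt-0 (px , py) (qx , qy) =
  ≡⇒≈ (mixℝ (ι px) (ι qx) (value 0I)) (fromℚ (ι px)) (λ _ → mix-0 (ι px) (ι qx)) ,
  ≡⇒≈ (mixℝ (ι py) (ι qy) (value 0I)) (fromℚ (ι py)) (λ _ → mix-0 (ι py) (ι qy))
  where
  open ℚ.+-*-Solver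
  mix-0 : ∀ p q → mix p q 0ℚ ≡ p
  mix-0 = solve 2 (λ p q → p :+ (q :- p) :* con 0ℚ := p) refl

alongAt-1 : ∀ P Q → alongAt (P , Q) 1I ≈² place Q
alongAt-1 (px , py) (qx , qy) =
  ≡⇒≈ (mixℝ (ι px) (ι qx) (value 1I)) (fromℚ (ι qx)) (λ _ → mix-1 (ι px) (ι qx)) ,
  ≡⇒≈ (mixℝ (ι py) (ι qy) (value 1I)) (fromℚ (ι qy)) (λ _ → mix-1 (ι py) (ι qy))
  where
  open ℚ.+-*-Solver
  mix-1 : ∀ p q → mix p q 1ℚ ≡ q
  mix-1 = solve 2 (λ p q → p :+ (q :- p) :* con 1ℚ := q) refl

-- Avoiding a vertex thus becomes a case of disjointness of two segments.
alongAt-degenerate : ∀ e s V → alongAt e s ≈² place V → alongAt e s ≈² alongAt (V , V) s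
alongAt-degenerate e s (vx , vy) (x≈ , y≈) =
  null-cong (λ n → cong (λ z → seq (proj₁ (alongAt e s)) n - z) (sym (mix-constant (ι vx) (seq (value s) n)))) x≈ ,
  null-cong (λ n → cong (λ z → seq (proj₂ (alongAt e s)) n - z) (sym (mix-constant (ι vy) (seq (value s) n)))) y≈

-- Orientation tests

-- Twice the signed area of the triangle, positive when the third point lies to the left of the
-- directed line through the first two.
orient : Point → Point → Point → ℤ
orient (px , py) (qx , qy) (rx , ry) = (qx ℤ.- px) ℤ.* (ry ℤ.- py) ℤ.- (qy ℤ.- py) ℤ.* (rx ℤ.- px)

-- The direction vector turned counterclockwise by a right angle, so that as a linear form it is
-- constant on the segment and grows to its left.
normal : Segment → Point
normal ((px , py) , (qx , qy)) = py ℤ.- qy , qx ℤ.- px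

⟨normal⟩-constant : ∀ P Q → ⟨ normal (P , Q) , Q ⟩ ≡ ⟨ normal (P , Q) , P ⟩
⟨normal⟩-constant (px , py) (qx , qy) = solve 4 (λ px py qx qy →
  (py :- qy) :* qx :+ (qx :- px) :* qy := (py :- qy) :* px :+ (qx :- px) :* py) refl px py qx qy
  where open ℤ.+-*-Solver

⟨normal⟩ : ∀ P Q R → ⟨ normal (P , Q) , R ⟩ ≡ ⟨ normal (P , Q) , P ⟩ ℤ.+ orient P Q R
⟨normal⟩ (px , py) (qx , qy) (rx , ry) = solve 6 (λ px py qx qy rx ry →
  (py :- qy) :* rx :+ (qx :- px) :* ry :=
  ((py :- qy) :* px :+ (qx :- px) :* py) :+ ((qx :- px) :* (ry :- py) :- (qy :- py) :* (rx :- px)))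
  refl px py qx qy rx ry
  where open ℤ.+-*-Solver

LeftOf : Segment → Segment → Set
LeftOf (P , Q) (R , S) =
  ℤ.0ℤ ℤ.≤ orient P Q R × ℤ.0ℤ ℤ.≤ orient P Q S × ℤ.0ℤ ℤ.< orient P Q R ℤ.+ orient P Q S

-- The form `normal e` has the same value at both ends of `e` and exceeds it at any other point by
-- the orientation of that point.
leftOf⇒separates : ∀ e f → LeftOf e f → Separates (normal e) ⟨ normal e , proj₁ e ⟩ e f
leftOf⇒separates e@(P , Q) (R , S) (0≤r , 0≤u , 0<r+u) =
  ℤ.≤-refl , ℤ.≤-reflexive (⟨normal⟩-constant P Q) , above R 0≤r , above S 0≤u , strict
  where
  c = ⟨ normal e , P ⟩
  above : ∀ T → ℤ.0ℤ ℤ.≤ orient P Q T → c ℤ.≤ ⟨ normal e , T ⟩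
  above T 0≤t = subst₂ ℤ._≤_ (ℤ.+-identityʳ c) (sym (⟨normal⟩ P Q T)) (ℤ.+-monoʳ-≤ c 0≤t)
  strict : c ℤ.+ ⟨ normal e , Q ⟩ ℤ.< ⟨ normal e , R ⟩ ℤ.+ ⟨ normal e , S ⟩
  strict = begin-strict
    c ℤ.+ ⟨ normal e , Q ⟩                              ≡⟨ cong (λ z → c ℤ.+ z) (⟨normal⟩-constant P Q) ⟩
    c ℤ.+ c                                             ≡⟨ ℤ.+-identityʳ (c ℤ.+ c) ⟨
    c ℤ.+ c ℤ.+ ℤ.0ℤ                                    <⟨ ℤ.+-monoʳ-< (c ℤ.+ c) 0<r+u ⟩
    c ℤ.+ c ℤ.+ (orient P Q R ℤ.+ orient P Q S)         ≡⟨ solve 3 (λ c r u → c :+ c :+ (r :+ u) := (c :+ r) :+ (c :+ u)) refl c (orient P Q R) (orient P Q S) ⟩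
    (c ℤ.+ orient P Q R) ℤ.+ (c ℤ.+ orient P Q S)       ≡⟨ cong₂ ℤ._+_ (⟨normal⟩ P Q R) (⟨normal⟩ P Q S) ⟨
    ⟨ normal e , R ⟩ ℤ.+ ⟨ normal e , S ⟩               ∎
    where open ℤ.≤-Reasoning ; open ℤ.+-*-Solver

flip : Segment → Segment
flip (P , Q) = Q , P

separates-flip : ∀ φ c e f → Separates φ c (flip e) f → Separates φ c e f
separates-flip φ c (P , Q) (R , S) (q≤c , p≤c , c≤r , c≤u , lt) =
  p≤c , q≤c , c≤r , c≤u , subst (ℤ._< ⟨ φ , R ⟩ ℤ.+ ⟨ φ , S ⟩) (ℤ.+-comm ⟨ φ , Q ⟩ ⟨ φ , P ⟩) lt

Beside : Segment → Segment → Set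
Beside e f = LeftOf e f ⊎ LeftOf (flip e) f

-- Two nondegenerate segments on different lines without a common interior point always pass: if
-- each line had the endpoints of the other segment strictly on opposite sides, the interiors would
-- cross. Collinear segments fail, and for them only vertical lines can help.
Apart : Segment → Segment → Set
Apart e f = Beside e f ⊎ Beside f e

Disjoint : Segment → Segment → Set
Disjoint e f = ∀ s t → Interior s → Interior t → ¬ (alongAt e s ≈² alongAt f t)

disjoint-sym : ∀ e f → Disjoint e f → Disjoint f e
disjoint-sym e f e∥f s t s-int t-int meet = e∥f t s t-int s-int (≈²-sym (alongAt f s) (alongAt e t) meet)

beside⇒disjoint : ∀ e f → Beside e f → Disjoint e f
beside⇒disjoint e f (inj₁ left) = separated⇒¬meet (normal e) _ e f (leftOf⇒separates e f left)
beside⇒disjoint e f (inj₂ left) = separated⇒¬meet (normal (flip e)) _ e f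
  (separates-flip (normal (flip e)) _ e f (leftOf⇒separates (flip e) f left))

apart⇒disjoint : ∀ e f → Apart e f → Disjoint e f
apart⇒disjoint e f (inj₁ b) = beside⇒disjoint e f b
apart⇒disjoint e f (inj₂ b) = disjoint-sym f e (beside⇒disjoint f e b)

-- The separating line is the vertical one through `Q`. Strictness is demanded only between the
-- outermost points, so the segments may share an endpoint and one of them may shrink to a vertex.
x-separated⇒disjoint : ∀ P Q R S → proj₁ P ℤ.≤ proj₁ Q → proj₁ Q ℤ.≤ proj₁ R → proj₁ R ℤ.≤ proj₁ S →
  proj₁ P ℤ.< proj₁ S → Disjoint (P , Q) (R , S)
x-separated⇒disjoint P Q R S p≤q q≤r r≤u p<u = separated⇒¬meet abscissa (proj₁ Q) (P , Q) (R , S)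
  ( ℤ.≤-trans (ℤ.≤-reflexive (x≡ P)) p≤q
  , ℤ.≤-reflexive (x≡ Q)
  , ℤ.≤-trans q≤r (ℤ.≤-reflexive (sym (x≡ R)))
  , ℤ.≤-trans (ℤ.≤-trans q≤r r≤u) (ℤ.≤-reflexive (sym (x≡ S)))
  , subst₂ ℤ._<_ (sym (cong₂ ℤ._+_ (x≡ P) (x≡ Q))) (sym (trans (cong₂ ℤ._+_ (x≡ R) (x≡ S)) (ℤ.+-comm (proj₁ R) (proj₁ S))))
      (ℤ.+-mono-<-≤ p<u q≤r) )
  where
  abscissa : Point
  abscissa = ℤ.1ℤ , ℤ.0ℤ
  x≡ : ∀ T → ⟨ abscissa , T ⟩ ≡ proj₁ T
  x≡ (x , y) = trans (ℤ.+-identityʳ (ℤ.1ℤ ℤ.* x)) (ℤ.*-identityˡ x)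

off-line⇒disjoint : ∀ e V → orient (proj₁ e) (proj₂ e) V ≢ ℤ.0ℤ → Disjoint e (V , V)
off-line⇒disjoint e@(P , Q) V o≢0 with ℤ.<-cmp ℤ.0ℤ (orient P Q V)
... | tri< 0<o _ _ = beside⇒disjoint e (V , V) (inj₁ (ℤ.<⇒≤ 0<o , ℤ.<⇒≤ 0<o , ℤ.+-mono-< 0<o 0<o))
... | tri≈ _ 0≡o _ = contradiction (sym 0≡o) o≢0
... | tri> _ _ o<0 = beside⇒disjoint e (V , V) (inj₂ (ℤ.<⇒≤ 0<o′ , ℤ.<⇒≤ 0<o′ , ℤ.+-mono-< 0<o′ 0<o′))
  where
  orient-flip : ∀ P Q R → orient Q P R ≡ ℤ.- orient P Q R
  orient-flip (px , py) (qx , qy) (rx , ry) = solve 6 (λ px py qx qy rx ry →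
    (px :- qx) :* (ry :- qy) :- (py :- qy) :* (rx :- qx) :=
    :- ((qx :- px) :* (ry :- py) :- (qy :- py) :* (rx :- px))) refl px py qx qy rx ry
    where open ℤ.+-*-Solver
  0<o′ : ℤ.0ℤ ℤ.< orient Q P V
  0<o′ = subst (ℤ.0ℤ ℤ.<_) (sym (orient-flip P Q V)) (ℤ.neg-mono-< o<0)

-- Uniqueness of crossings

Transversal : Segment → Segment → Set
Transversal (P , Q) (R , S) = orient R S P ≢ orient R S Q

-- The form `normal f` is constant on `f`, hence takes the same value at both meeting points.
-- Transversality means that `e` is not parallel to `f`, so along `e` this value determines the
-- parameter.
transversal⇒unique : ∀ e f → Transversal e f → ∀ s t s′ t′ →
  alongAt e s ≈² alongAt f t → alongAt e s′ ≈² alongAt f t′ → value s ≈ value s′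
transversal⇒unique e@(P , Q) f@(R , S) p≢q s t s′ t′ meet meet′ =
  mix-injective A≢B (seq (value s)) (seq (value s′)) (null-cong eq
    (null-+ (meet⇒null e f s t meet φ) (null-* (- 1ℚ) (meet⇒null e f s′ t′ meet′ φ))))
  where
  φ = normal f
  A = ι ⟨ φ , P ⟩
  B = ι ⟨ φ , Q ⟩
  A≢B : A ≢ B
  A≢B A≡B = p≢q (AbelianGroup.∙-cancelˡ ℤ.+-0-abelianGroup ⟨ φ , R ⟩ _ _
    (trans (sym (⟨normal⟩ R S P)) (trans (ι-injective A≡B) (⟨normal⟩ R S Q))))
  along-f : ∀ t n → along f φ t n ≡ ι ⟨ φ , R ⟩
  along-f t n = trans (cong (λ z → mix (ι ⟨ φ , R ⟩) (ι z) (seq (value t) n)) (⟨normal⟩-constant R S))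
    (mix-constant (ι ⟨ φ , R ⟩) (seq (value t) n))
  eq : ∀ n → (along e φ s n - along f φ t n) + - 1ℚ * (along e φ s′ n - along f φ t′ n) ≡
    along e φ s n - along e φ s′ n
  eq n = trans (cong₂ (λ y z → (along e φ s n - y) + - 1ℚ * (along e φ s′ n - z)) (along-f t n) (along-f t′ n))
    (solve 3 (λ x y c → (x :- c) :+ con (- 1ℚ) :* (y :- c) := x :- y) refl
      (along e φ s n) (along e φ s′ n) (ι ⟨ φ , R ⟩))
    where open ℚ.+-*-Solver

-- Invariance under horizontal translation

shift : ℤ → Point → Point
shift d (x , y) = x ℤ.+ d , y

shiftSegment : ℤ → Segment → Segment
shiftSegment d (P , Q) = shift d P , shift d Q

orient-shift : ∀ d P Q R → orient (shift d P) (shift d Q) (shift d R) ≡ orient P Q R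
orient-shift d (px , py) (qx , qy) (rx , ry) = solve 7 (λ d px py qx qy rx ry →
  ((qx :+ d) :- (px :+ d)) :* (ry :- py) :- (qy :- py) :* ((rx :+ d) :- (px :+ d)) :=
  (qx :- px) :* (ry :- py) :- (qy :- py) :* (rx :- px)) refl d px py qx qy rx ry
  where open ℤ.+-*-Solver

leftOf-shift : ∀ d e f → LeftOf e f → LeftOf (shiftSegment d e) (shiftSegment d f)
leftOf-shift d (P , Q) (R , S) (0≤r , 0≤u , 0<r+u) =
  subst (ℤ.0ℤ ℤ.≤_) (sym (orient-shift d P Q R)) 0≤r ,
  subst (ℤ.0ℤ ℤ.≤_) (sym (orient-shift d P Q S)) 0≤u ,
  subst (ℤ.0ℤ ℤ.<_) (sym (cong₂ ℤ._+_ (orient-shift d P Q R) (orient-shift d P Q S))) 0<r+u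

apart-shift : ∀ d e f → Apart e f → Apart (shiftSegment d e) (shiftSegment d f)
apart-shift d e f = Sum.map (beside e f) (beside f e)
  where
  beside : ∀ e f → Beside e f → Beside (shiftSegment d e) (shiftSegment d f)
  beside e f = Sum.map (leftOf-shift d e f) (leftOf-shift d (flip e) f)

transversal-shift : ∀ d e f → Transversal e f → Transversal (shiftSegment d e) (shiftSegment d f)
transversal-shift d (P , Q) (R , S) p≢q eq =
  p≢q (trans (sym (orient-shift d R S P)) (trans eq (orient-shift d R S Q)))

-- Decidability of the tests

leftOf? : ∀ e f → Dec (LeftOf e f)
leftOf? (P , Q) (R , S) =
  (ℤ.0ℤ ℤ.≤? orient P Q R) ×-dec (ℤ.0ℤ ℤ.≤? orient P Q S) ×-dec (ℤ.0ℤ ℤ.<? orient P Q R ℤ.+ orient P Q S)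

apart? : ∀ e f → Dec (Apart e f)
apart? e f = beside? e f ⊎-dec beside? f e
  where
  beside? : ∀ e f → Dec (Beside e f)
  beside? e f = leftOf? e f ⊎-dec leftOf? (flip e) f

transversal? : ∀ e f → Dec (Transversal e f)
transversal? (P , Q) (R , S) = ¬? (orient R S P ℤ.≟ orient R S Q)

lookup-injective : ∀ {A : Set} {xs : List A} → Unique xs → ∀ i j → lookup xs i ≡ lookup xs j → i ≡ j
lookup-injective (_ ∷ _)        Fin.zero    Fin.zero    _  = refl
lookup-injective (x∉xs ∷ _)     Fin.zero    (Fin.suc j) eq = contradiction eq (All.lookup x∉xs (∈-lookup j))
lookup-injective (x∉xs ∷ _)     (Fin.suc i) Fin.zero    eq = contradiction (sym eq) (All.lookup x∉xs (∈-lookup i))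
lookup-injective (_ ∷ xs-unique) (Fin.suc i) (Fin.suc j) eq = cong Fin.suc (lookup-injective xs-unique i j eq)

-- Copies of a block

Label : Set
Label = ℕ × ℕ

_≟ᴸ_ : ∀ (e f : Label) → Dec (e ≡ f)
_≟ᴸ_ = ≡-dec ℕ._≟_ ℕ._≟_

open import Data.List.Relation.Unary.Unique.DecPropositional _≟ᴸ_ using (unique?)

neighbours : List Label → ℕ → List ℕ
neighbours edges u =
  map proj₂ (filter (λ e → proj₁ e ℕ.≟ u) edges) ++ map proj₁ (filter (λ e → proj₂ e ℕ.≟ u) edges)

∈-neighbours⁺ : ∀ edges {u v} → (u , v) ∈ edges ⊎ (v , u) ∈ edges → v ∈ neighbours edges u
∈-neighbours⁺ edges {u} (inj₁ uv∈) = ∈-++⁺ˡ (∈-map⁺ proj₂ (∈-filter⁺ (λ e → proj₁ e ℕ.≟ u) uv∈ refl))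
∈-neighbours⁺ edges {u} (inj₂ vu∈) = ∈-++⁺ʳ _ (∈-map⁺ proj₁ (∈-filter⁺ (λ e → proj₂ e ℕ.≟ u) vu∈ refl))

∈-neighbours⁻ : ∀ edges {u v} → v ∈ neighbours edges u → (u , v) ∈ edges ⊎ (v , u) ∈ edges
∈-neighbours⁻ edges {u} v∈ with ∈-++⁻ (map proj₂ (filter (λ e → proj₁ e ℕ.≟ u) edges)) v∈
... | inj₁ v∈₁ with ∈-map⁻ proj₂ v∈₁
...   | (_ , _) , e∈ , refl with ∈-filter⁻ (λ e → proj₁ e ℕ.≟ u) {xs = edges} e∈
...     | e∈edges , refl = inj₁ e∈edges
∈-neighbours⁻ edges {u} v∈ | inj₂ v∈₂ with ∈-map⁻ proj₁ v∈₂
...   | (_ , _) , e∈ , refl with ∈-filter⁻ (λ e → proj₂ e ℕ.≟ u) {xs = edges} e∈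
...     | e∈edges , refl = inj₂ e∈edges

∈-neighbours-sym : ∀ edges {u v} → v ∈ neighbours edges u → u ∈ neighbours edges v
∈-neighbours-sym edges = ∈-neighbours⁺ edges ∘ Sum.swap ∘ ∈-neighbours⁻ edges

module _ (position : ℕ → Point) where

  segment : Label → Segment
  segment (a , b) = position a , position b

  -- The first two alternatives are the separations by vertical lines: labels will increase with the
  -- abscissa, so comparing labels replaces comparing coordinates.
  Clear : Label → Label → Set
  Clear e@(a , b) f@(c , d) = b ℕ.≤ c ⊎ d ℕ.≤ a ⊎ Apart (segment e) (segment f)

  Rival : Label → Label → Set
  Rival e f = f ≢ e × ¬ Clear e f

  rival? : ∀ e f → Dec (Rival e f)
  rival? e@(a , b) f@(c , d) =
    ¬? (f ≟ᴸ e) ×-dec ¬? ((b ℕ.≤? c) ⊎-dec (d ℕ.≤? a) ⊎-dec apart? (segment e) (segment f))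

  rivals : List Label → Label → List Label
  rivals edges e = filter (rival? e) edges

-- few-rivals bounds the number of crossings from above, since rivals are the
-- edges that the separation tests fail to exclude; no-short-cycle says that
-- the ball of radius two around u is a tree.
record Block : Set where
  field
    order    : ℕ
    {{order-nonZero}} : NonZero order
    position : ℕ → Point
    width    : ℕ
    edges    : List Label
    edges-unique  : Unique edges
    edges-ordered : All (λ (a , b) → a ℕ.< b × b ℕ.< order) edges
    x-increasing  : ∀ {b} → b ℕ.< order → ∀ {a} → a ℕ.< b → proj₁ (position a) ℤ.< proj₁ (position b)
    -- As `a` and `b` range over all ordered pairs, this bounds the horizontal extent of the block
    -- strictly by `width`, so consecutive translates do not interleave.
    x-spread      : ∀ {a} → a ℕ.< order → ∀ {b} → b ℕ.< order →
      proj₁ (position a) ℤ.< proj₁ (position b) ℤ.+ + width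
    -- Only the vertices strictly between `a` and `b` are tested; vertical lines take care of all
    -- others.
    off-edges     : All (λ (a , b) → ∀ {v} → v ℕ.< b →
      v ℕ.≤ a ⊎ orient (position a) (position b) (position v) ≢ ℤ.0ℤ) edges
    few-rivals    : All (λ e → length (rivals position edges e) ℕ.≤ 2 ×
      All (λ f → Transversal (segment position e) (segment position f)) (rivals position edges e)) edges
    no-short-cycle : ∀ {u} → u ℕ.< order →
      All (λ v → All (λ w → v ≡ w ⊎
        (w ∉ neighbours edges v × All (λ z → z ≡ u ⊎ z ∉ neighbours edges w) (neighbours edges v)))
        (neighbours edges u)) (neighbours edges u)
    pentagon           : Fin 5 → ℕ
    pentagon<order     : ∀ i → pentagon i ℕ.< order
    pentagon-injective : ∀ i j → pentagon i ≡ pentagon j → i ≡ j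
    pentagon-step      : ∀ (i : Fin 4) → pentagon (Fin.suc i) ∈ neighbours edges (pentagon (inject₁ i))
    pentagon-close     : pentagon Fin.zero ∈ neighbours edges (pentagon (fromℕ 4))

-- The last n % order vertices form an incomplete copy, which receives no edges.
module Copies (B : Block) (n : ℕ) where
  open Block B

  copies : ℕ
  copies = n ℕ./ order

  vtx : ℕ → ℕ → ℕ
  vtx i a = a ℕ.+ i ℕ.* order

  vtx-% : ∀ i {a} → a ℕ.< order → vtx i a ℕ.% order ≡ a
  vtx-% i {a} a<N = trans (ℕ.[m+kn]%n≡m%n a i order) (ℕ.m<n⇒m%n≡m a<N)

  vtx-/ : ∀ i {a} → a ℕ.< order → vtx i a ℕ./ order ≡ i
  vtx-/ i {a} a<N = trans (ℕ.+-distrib-/-∣ʳ a (ℕ.divides-refl i))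
    (cong₂ ℕ._+_ (ℕ.m<n⇒m/n≡0 a<N) (ℕ.m*n/n≡m i order))

  vtx-surjective : ∀ v → v ≡ vtx (v ℕ./ order) (v ℕ.% order)
  vtx-surjective v = ℕ.m≡m%n+[m/n]*n v order

  vtx-mono : ∀ {i j a} b → i ℕ.< j → a ℕ.< order → vtx i a ℕ.< vtx j b
  vtx-mono {i} {j} {a} b i<j a<N = begin-strict
    a ℕ.+ i ℕ.* order         <⟨ ℕ.+-monoˡ-< (i ℕ.* order) a<N ⟩
    ℕ.suc i ℕ.* order         ≤⟨ ℕ.*-monoˡ-≤ order i<j ⟩
    j ℕ.* order               ≤⟨ ℕ.m≤n+m (j ℕ.* order) b ⟩
    b ℕ.+ j ℕ.* order         ∎
    where open ℕ.≤-Reasoning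

  vtx<n : ∀ {i a} → i ℕ.< copies → a ℕ.< order → vtx i a ℕ.< n
  vtx<n {i} {a} i<k a<N = ℕ.<-≤-trans (vtx-mono 0 i<k a<N) (ℕ.m/n*n≤m n order)

  site : ℕ → Point
  site v = shift (+ (v ℕ./ order ℕ.* width)) (position (v ℕ.% order))

  site-vtx : ∀ i {a} → a ℕ.< order → site (vtx i a) ≡ shift (+ (i ℕ.* width)) (position a)
  site-vtx i a<N = cong₂ (λ j b → shift (+ (j ℕ.* width)) (position b)) (vtx-/ i a<N) (vtx-% i a<N)

  x-vtx-increasing : ∀ i j {a b} → a ℕ.< order → b ℕ.< order → vtx i a ℕ.< vtx j b →
    proj₁ (shift (+ (i ℕ.* width)) (position a)) ℤ.< proj₁ (shift (+ (j ℕ.* width)) (position b))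
  x-vtx-increasing i j {a} {b} a<N b<N lt with ℕ.<-cmp i j
  ... | tri> _ _ j<i = contradiction lt (ℕ.<⇒≯ (vtx-mono a j<i b<N))
  ... | tri≈ _ refl _ = ℤ.+-monoˡ-< (+ (i ℕ.* width)) (x-increasing b<N (ℕ.+-cancelʳ-< (i ℕ.* order) a b lt))
  -- By `x-spread` all of copy `i` lies to the left of its translate by one further `width`, and
  -- copy `j` is that translate or lies beyond it.
  ... | tri< i<j _ _ = begin-strict
    proj₁ (position a) ℤ.+ + (i ℕ.* width)                      <⟨ ℤ.+-monoˡ-< (+ (i ℕ.* width)) (x-spread a<N b<N) ⟩
    proj₁ (position b) ℤ.+ + width ℤ.+ + (i ℕ.* width)          ≡⟨ ℤ.+-assoc (proj₁ (position b)) (+ width) (+ (i ℕ.* width)) ⟩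
    proj₁ (position b) ℤ.+ + (ℕ.suc i ℕ.* width)                ≤⟨ ℤ.+-monoʳ-≤ (proj₁ (position b)) (ℤ.+≤+ (ℕ.*-monoˡ-≤ width i<j)) ⟩
    proj₁ (position b) ℤ.+ + (j ℕ.* width)                      ∎
    where open ℤ.≤-Reasoning

  x-site-< : ∀ {v w} → v ℕ.< w → proj₁ (site v) ℤ.< proj₁ (site w)
  x-site-< {v} {w} v<w = x-vtx-increasing (v ℕ./ order) (w ℕ./ order) (ℕ.m%n<n v order) (ℕ.m%n<n w order)
    (subst₂ ℕ._<_ (vtx-surjective v) (vtx-surjective w) v<w)

  x-site-≤ : ∀ {v w} → v ℕ.≤ w → proj₁ (site v) ℤ.≤ proj₁ (site w)
  x-site-≤ v≤w with ℕ.m≤n⇒m<n∨m≡n v≤w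
  ... | inj₁ v<w  = ℤ.<⇒≤ (x-site-< v<w)
  ... | inj₂ refl = ℤ.≤-refl

  site-injective : ∀ {v w} → site v ≡ site w → v ≡ w
  site-injective {v} {w} eq with ℕ.<-cmp v w
  ... | tri< v<w _ _ = contradiction (cong proj₁ eq) (ℤ.<⇒≢ (x-site-< v<w))
  ... | tri≈ _ v≡w _ = v≡w
  ... | tri> _ _ w<v = contradiction (cong proj₁ (sym eq)) (ℤ.<⇒≢ (x-site-< w<v))

  -- The graph formed by the copies

  Edge : Set
  Edge = Fin (copies ℕ.* length edges)

  copy : Edge → Fin copies
  copy e = proj₁ (remQuot {copies} (length edges) e)

  slot : Edge → Fin (length edges)
  slot e = proj₂ (remQuot {copies} (length edges) e)

  label : Edge → Label
  label e = lookup edges (slot e)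

  label∈ : ∀ e → label e ∈ edges
  label∈ e = ∈-lookup (slot e)

  edge-ext : ∀ {e f} → copy e ≡ copy f → label e ≡ label f → e ≡ f
  edge-ext {e} {f} copy≡ label≡ = begin
    e                          ≡⟨ Fin.combine-remQuot {copies} (length edges) e ⟨
    combine (copy e) (slot e)  ≡⟨ cong₂ combine copy≡ (lookup-injective edges-unique (slot e) (slot f) label≡) ⟩
    combine (copy f) (slot f)  ≡⟨ Fin.combine-remQuot {copies} (length edges) f ⟩
    f                          ∎
    where open ≡-Reasoning

  a<b : ∀ e → proj₁ (label e) ℕ.< proj₂ (label e)
  a<b e = proj₁ (All.lookup edges-ordered (label∈ e))

  b<N : ∀ e → proj₂ (label e) ℕ.< order
  b<N e = proj₂ (All.lookup edges-ordered (label∈ e))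

  a<N : ∀ e → proj₁ (label e) ℕ.< order
  a<N e = ℕ.<-trans (a<b e) (b<N e)

  left right : Edge → ℕ
  left e = vtx (toℕ (copy e)) (proj₁ (label e))
  right e = vtx (toℕ (copy e)) (proj₂ (label e))

  left<right : ∀ e → left e ℕ.< right e
  left<right e = ℕ.+-monoˡ-< (toℕ (copy e) ℕ.* order) (a<b e)

  left<n : ∀ e → left e ℕ.< n
  left<n e = vtx<n (Fin.toℕ<n (copy e)) (a<N e)

  right<n : ∀ e → right e ℕ.< n
  right<n e = vtx<n (Fin.toℕ<n (copy e)) (b<N e)

  vtx-injectiveˡ : ∀ i j {a b} → a ℕ.< order → b ℕ.< order → vtx i a ≡ vtx j b → i ≡ j
  vtx-injectiveˡ i j a<N b<N eq = trans (sym (vtx-/ i a<N)) (trans (cong (ℕ._/ order) eq) (vtx-/ j b<N))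

  vtx-injectiveʳ : ∀ i j {a b} → a ℕ.< order → b ℕ.< order → vtx i a ≡ vtx j b → a ≡ b
  vtx-injectiveʳ i j a<N b<N eq = trans (sym (vtx-% i a<N)) (trans (cong (ℕ._% order) eq) (vtx-% j b<N))

  graph : Graph n
  graph = record
    { size           = copies ℕ.* length edges
    ; ends           = λ e → fromℕ< (left<n e) , fromℕ< (right<n e)
    ; ends-ordered   = λ e → subst₂ ℕ._<_ (sym (Fin.toℕ-fromℕ< (left<n e))) (sym (Fin.toℕ-fromℕ< (right<n e))) (left<right e)
    ; ends-injective = λ {e} {f} eq →
        let left≡  = Fin.fromℕ<-injective (left e) (left f) (left<n e) (left<n f) (cong proj₁ eq)
            right≡ = Fin.fromℕ<-injective (right e) (right f) (right<n e) (right<n f) (cong proj₂ eq)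
        in edge-ext {e} {f} (Fin.toℕ-injective (vtx-injectiveˡ (toℕ (copy e)) (toℕ (copy f)) (a<N e) (a<N f) left≡))
             (cong₂ _,_ (vtx-injectiveʳ (toℕ (copy e)) (toℕ (copy f)) (a<N e) (a<N f) left≡)
                        (vtx-injectiveʳ (toℕ (copy e)) (toℕ (copy f)) (b<N e) (b<N f) right≡))
    }

  -- The straight-line drawing

  drawn : Edge → Segment
  drawn e = site (left e) , site (right e)

  offset : Edge → ℤ
  offset e = + (toℕ (copy e) ℕ.* width)

  drawn-shift : ∀ e → drawn e ≡ shiftSegment (offset e) (segment position (label e))
  drawn-shift e = cong₂ _,_ (site-vtx (toℕ (copy e)) (a<N e)) (site-vtx (toℕ (copy e)) (b<N e))

  drawn-shift′ : ∀ e f → copy e ≡ copy f → drawn f ≡ shiftSegment (offset e) (segment position (label f))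
  drawn-shift′ e f same = trans (drawn-shift f)
    (cong (λ i → shiftSegment (+ (toℕ i ℕ.* width)) (segment position (label f))) (sym same))

  -- A vertex numbered outside the span of the edge is cut off by a vertical line. One numbered
  -- strictly inside must belong to the same copy, because copies occupy consecutive blocks of
  -- numbers; translation then reduces the claim to `off-edges`.
  avoids : ∀ e v → Disjoint (drawn e) (site v , site v)
  avoids e v with v ℕ.≤? left e | right e ℕ.≤? v
  ... | yes v≤left | _ = disjoint-sym (site v , site v) (drawn e) 
    (x-separated⇒disjoint (site v) (site v) (site (left e)) (site (right e))
      ℤ.≤-refl (x-site-≤ v≤left) (x-site-≤ (ℕ.<⇒≤ (left<right e))) (x-site-< (ℕ.≤-<-trans v≤left (left<right e))))
  ... | no _ | yes right≤v = x-separated⇒disjoint (site (left e)) (site (right e)) (site v) (site v)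
    (x-site-≤ (ℕ.<⇒≤ (left<right e))) (x-site-≤ right≤v) ℤ.≤-refl (x-site-< (ℕ.<-≤-trans (left<right e) right≤v))
  ... | no v≰left | no right≰v = off-line⇒disjoint (drawn e) (site v) (subst (_≢ ℤ.0ℤ) (sym orient≡) off)
    where
    i = toℕ (copy e)
    a = proj₁ (label e)
    b = proj₂ (label e)
    c = v ℕ.% order
    v≡ : v ≡ vtx (v ℕ./ order) c
    v≡ = vtx-surjective v
    left<v : left e ℕ.< vtx (v ℕ./ order) c
    left<v = subst (left e ℕ.<_) v≡ (ℕ.≰⇒> v≰left)
    v<right : vtx (v ℕ./ order) c ℕ.< right e
    v<right = subst (ℕ._< right e) v≡ (ℕ.≰⇒> right≰v)
    same : v ℕ./ order ≡ i
    same with ℕ.<-cmp (v ℕ./ order) i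
    ... | tri< lt _ _ = contradiction left<v (ℕ.<⇒≯ (vtx-mono a lt (ℕ.m%n<n v order)))
    ... | tri≈ _ eq _ = eq
    ... | tri> _ _ gt = contradiction v<right (ℕ.<⇒≯ (vtx-mono c gt (b<N e)))
    a<c : a ℕ.< c
    a<c = ℕ.+-cancelʳ-< (i ℕ.* order) a c (subst (λ j → left e ℕ.< vtx j c) same left<v)
    c<b : c ℕ.< b
    c<b = ℕ.+-cancelʳ-< (i ℕ.* order) c b (subst (λ j → vtx j c ℕ.< right e) same v<right)
    off : orient (position a) (position b) (position c) ≢ ℤ.0ℤ
    off with All.lookup off-edges (label∈ e) c<b
    ... | inj₁ c≤a = contradiction a<c (ℕ.≤⇒≯ c≤a)
    ... | inj₂ ≢0  = ≢0
    site-v : site v ≡ shift (offset e) (position c)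
    site-v = cong (λ j → shift (+ (j ℕ.* width)) (position c)) same
    orient≡ : orient (site (left e)) (site (right e)) (site v) ≡ orient (position a) (position b) (position c)
    orient≡ = trans (cong₂ (λ { (P , Q) V → orient P Q V }) (drawn-shift e) site-v)
      (orient-shift (offset e) (position a) (position b) (position c))

  drawing : Drawing graph
  drawing = record
    { point           = λ v → place (site (toℕ v))
    ; point-injective = λ u v eq → Fin.toℕ-injective (site-injective (place-injective (site (toℕ u)) (site (toℕ v)) eq))
    ; arc             = λ e → segmentArc (drawn e) (x-site-< (left<right e))
    ; arc-start       = λ e → subst (λ v → alongAt (drawn e) 0I ≈² place (site v)) (sym (Fin.toℕ-fromℕ< (left<n e)))
        (alongAt-0 (site (left e)) (site (right e)))
    ; arc-end         = λ e → subst (λ v → alongAt (drawn e) 1I ≈² place (site v)) (sym (Fin.toℕ-fromℕ< (right<n e)))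
        (alongAt-1 (site (left e)) (site (right e)))
    -- Every parameter of the degenerate segment gives the vertex, so the interior parameter `s` of
    -- the edge serves for both.
    ; avoids-vertices = λ e s s-int v meet →
        avoids e (toℕ v) s s s-int s-int (alongAt-degenerate (drawn e) s (site (toℕ v)) meet)
    }

  ordered⇒disjoint : ∀ e f → right e ℕ.≤ left f → Disjoint (drawn e) (drawn f)
  ordered⇒disjoint e f right≤left = x-separated⇒disjoint (site (left e)) (site (right e)) (site (left f)) (site (right f))
    (x-site-≤ (ℕ.<⇒≤ (left<right e))) (x-site-≤ right≤left) (x-site-≤ (ℕ.<⇒≤ (left<right f)))
    (x-site-< (ℕ.<-≤-trans (left<right e) (ℕ.≤-trans right≤left (ℕ.<⇒≤ (left<right f)))))

  copies-disjoint : ∀ e f → toℕ (copy e) ℕ.< toℕ (copy f) → Disjoint (drawn e) (drawn f)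
  copies-disjoint e f lt = ordered⇒disjoint e f (ℕ.<⇒≤ (vtx-mono (proj₁ (label f)) lt (b<N e)))

  clear⇒disjoint : ∀ e f → copy e ≡ copy f → Clear position (label e) (label f) → Disjoint (drawn e) (drawn f)
  clear⇒disjoint e f same (inj₁ b≤c) = ordered⇒disjoint e f
    (subst (λ i → right e ℕ.≤ vtx (toℕ i) (proj₁ (label f))) same (ℕ.+-monoˡ-≤ (toℕ (copy e) ℕ.* order) b≤c))
  clear⇒disjoint e f same (inj₂ (inj₁ d≤a)) = disjoint-sym (drawn f) (drawn e) (ordered⇒disjoint f e
    (subst (λ i → right f ℕ.≤ vtx (toℕ i) (proj₁ (label e))) (sym same) (ℕ.+-monoˡ-≤ (toℕ (copy f) ℕ.* order) d≤a)))
  clear⇒disjoint e f same (inj₂ (inj₂ apart)) = apart⇒disjoint (drawn e) (drawn f)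
    (subst₂ Apart (sym (drawn-shift e)) (sym (drawn-shift′ e f same))
      (apart-shift (offset e) (segment position (label e)) (segment position (label f)) apart))

  -- Crossings

  open Drawing drawing using (Crossing; SameCrossing; CrossedAtMost)
  open Crossing

  same-copy : ∀ {e} (c : Crossing e) → copy e ≡ copy (other c)
  same-copy {e} c with ℕ.<-cmp (toℕ (copy e)) (toℕ (copy (other c)))
  ... | tri< lt _ _ = contradiction (meet c)
    (copies-disjoint e (other c) lt (param c) (otherParam c) (param-interior c) (other-interior c))
  ... | tri≈ _ eq _ = Fin.toℕ-injective eq
  ... | tri> _ _ gt = contradiction (meet c)
    (disjoint-sym (drawn (other c)) (drawn e) (copies-disjoint (other c) e gt)
      (param c) (otherParam c) (param-interior c) (other-interior c))

  rival∈ : ∀ {e} (c : Crossing e) → label (other c) ∈ rivals position edges (label e)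
  rival∈ {e} c = ∈-filter⁺ (rival? position (label e)) (label∈ (other c))
    ( (λ eq → other≢ c (edge-ext (sym (same-copy c)) eq))
    , λ clear → clear⇒disjoint e (other c) (same-copy c) clear
        (param c) (otherParam c) (param-interior c) (other-interior c) (meet c) )

  transversal : ∀ {e} (c : Crossing e) → Transversal (drawn e) (drawn (other c))
  transversal {e} c = subst₂ Transversal (sym (drawn-shift e))
    (sym (drawn-shift′ e (other c) (same-copy c)))
    (transversal-shift (offset e) (segment position (label e)) (segment position (label (other c)))
      (All.lookup (proj₂ (All.lookup few-rivals (label∈ e))) (rival∈ c)))

  same-other⇒same : ∀ {e} (c d : Crossing e) → other c ≡ other d → SameCrossing c d
  same-other⇒same {e} c d eq = eq , transversal⇒unique (drawn e) (drawn (other c)) (transversal c)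
    (param c) (otherParam c) (param d) (otherParam d) (meet c)
    (subst (λ f → alongAt (drawn e) (param d) ≈² alongAt (drawn f) (otherParam d)) (sym eq) (meet d))

  -- Each crossing is sent to the position of its other edge in the list of rivals. Crossings with
  -- the same other edge coincide by transversality, so pairwise different crossings occupy
  -- different positions of a list of length at most two.
  crossed-at-most-twice : ∀ e → CrossedAtMost 2 e
  crossed-at-most-twice e m c c-injective = ℕ.≤-trans (Fin.injective⇒≤ {f = λ i → index (rival∈ (c i))} inj)
    (proj₁ (All.lookup few-rivals (label∈ e)))
    where
    inj : Injective _≡_ _≡_ (λ i → index (rival∈ (c i)))
    inj {i} {j} eq = c-injective (same-other⇒same (c i) (c j)
      (edge-ext (trans (sym (same-copy (c i))) (same-copy (c j)))
        (index-injective (setoid Label) (rival∈ (c i)) (rival∈ (c j)) eq)))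

  planar : KPlanar graph 2
  planar = drawing , crossed-at-most-twice

  -- Girth

  open Graph graph using (Adjacent; ends)

  copyᵛ residue : Fin n → ℕ
  copyᵛ v = toℕ v ℕ./ order
  residue v = toℕ v ℕ.% order

  residue-injective : ∀ {u v} → copyᵛ u ≡ copyᵛ v → residue u ≡ residue v → u ≡ v
  residue-injective {u} {v} c≡ r≡ = Fin.toℕ-injective
    (trans (vtx-surjective (toℕ u)) (trans (cong₂ vtx c≡ r≡) (sym (vtx-surjective (toℕ v)))))

  ends⇒edge : ∀ {u v} e → ends e ≡ (u , v) → copyᵛ u ≡ copyᵛ v × (residue u , residue v) ∈ edges
  ends⇒edge e refl
    rewrite Fin.toℕ-fromℕ< (left<n e) | Fin.toℕ-fromℕ< (right<n e)
          | vtx-/ (toℕ (copy e)) (a<N e) | vtx-/ (toℕ (copy e)) (b<N e)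
          | vtx-% (toℕ (copy e)) (a<N e) | vtx-% (toℕ (copy e)) (b<N e) = refl , label∈ e

  adjacent⇒neighbour : ∀ {u v} → Adjacent u v → copyᵛ u ≡ copyᵛ v × residue v ∈ neighbours edges (residue u)
  adjacent⇒neighbour (e , inj₁ eq) = let c≡ , e∈ = ends⇒edge e eq in c≡ , ∈-neighbours⁺ edges (inj₁ e∈)
  adjacent⇒neighbour (e , inj₂ eq) = let c≡ , e∈ = ends⇒edge e eq in sym c≡ , ∈-neighbours⁺ edges (inj₂ e∈)

  -- Adjacent vertices lie in the same copy, where distinct vertices have distinct residues, so the
  -- triangle would descend to the block. There `v` and `w` would be two adjacent neighbours of `u`.
  no-triangle : ∀ {u v w} → v ≢ w → Adjacent u v → Adjacent v w → ¬ Adjacent w u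
  no-triangle {u} {v} {w} v≢w uv vw wu with adjacent⇒neighbour uv | adjacent⇒neighbour vw | adjacent⇒neighbour wu
  ... | uv≡ , v∈u | vw≡ , w∈v | _ , u∈w
    with All.lookup (All.lookup (no-short-cycle (ℕ.m%n<n (toℕ u) order)) v∈u) (∈-neighbours-sym edges u∈w)
  ... | inj₁ v≡w = v≢w (residue-injective vw≡ v≡w)
  ... | inj₂ (w∉v , _) = w∉v w∈v

  -- Seen from `u`, the opposite vertex `z` would be a second common neighbour of the two distinct
  -- neighbours `v` and `w`.
  no-quadrilateral : ∀ {u v w z} → v ≢ w → z ≢ u → Adjacent u v → Adjacent v z → Adjacent z w → ¬ Adjacent w u
  no-quadrilateral {u} {v} {w} {z} v≢w z≢u uv vz zw wu
    with adjacent⇒neighbour uv | adjacent⇒neighbour vz | adjacent⇒neighbour zw | adjacent⇒neighbour wu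
  ... | uv≡ , v∈u | vz≡ , z∈v | zw≡ , w∈z | _ , u∈w
    with All.lookup (All.lookup (no-short-cycle (ℕ.m%n<n (toℕ u) order)) v∈u) (∈-neighbours-sym edges u∈w)
  ... | inj₁ v≡w = v≢w (residue-injective (trans vz≡ zw≡) v≡w)
  ... | inj₂ (_ , h) with All.lookup h z∈v
  ...   | inj₁ z≡u = z≢u (residue-injective (sym (trans uv≡ vz≡)) z≡u)
  ...   | inj₂ z∉w = z∉w (∈-neighbours-sym edges w∈z)

  5≤length : ∀ (c : Cycle graph) → 5 ℕ.≤ Cycle.length c
  5≤length record { last = 0 ; 3≤length = s≤s () }
  5≤length record { last = 1 ; 3≤length = s≤s (s≤s ()) }
  5≤length record { last = 2 ; distinct = distinct ; step = step ; close = close } =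
    contradiction close (no-triangle (λ eq → contradiction (distinct eq) λ ()) (step Fin.zero) (step (Fin.suc Fin.zero)))
  5≤length record { last = 3 ; distinct = distinct ; step = step ; close = close } =
    contradiction close (no-quadrilateral (λ eq → contradiction (distinct eq) λ ()) (λ eq → contradiction (distinct eq) λ ())
      (step Fin.zero) (step (Fin.suc Fin.zero)) (step (Fin.suc (Fin.suc Fin.zero))))
  5≤length record { last = suc (suc (suc (suc _))) } = s≤s (s≤s (s≤s (s≤s (s≤s z≤n))))

  module _ (order≤n : order ℕ.≤ n) where

    0<copies : 0 ℕ.< copies
    0<copies = ℕ.m≥n⇒m/n>0 order≤n

    -- In copy 0 the vertex numbers are the labels themselves. The pentagon is exhibited there, and
    -- `order≤n` ensures that this copy is complete.
    first : ∀ {a} → a ℕ.< order → Fin n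
    first a<N = fromℕ< (ℕ.<-≤-trans a<N order≤n)

    edge⇒adjacent : ∀ {a b} (a<N : a ℕ.< order) (b<N : b ℕ.< order) → (a , b) ∈ edges →
      ∃ λ e → ends e ≡ (first a<N , first b<N)
    edge⇒adjacent {a} {b} a<N′ b<N′ ab∈ = e , cong₂ _,_
      (Fin.fromℕ<-cong (left e) a left≡ (left<n e) _)
      (Fin.fromℕ<-cong (right e) b right≡ (right<n e) _)
      where
      i = fromℕ< 0<copies
      e = combine i (index ab∈)
      label≡ : label e ≡ (a , b)
      label≡ = trans (cong (lookup edges ∘ proj₂) (Fin.remQuot-combine i (index ab∈))) (sym (lookup-index ab∈))
      copy≡ : toℕ (copy e) ≡ 0
      copy≡ = trans (cong (toℕ ∘ proj₁) (Fin.remQuot-combine i (index ab∈))) (Fin.toℕ-fromℕ< 0<copies)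
      left≡ : left e ≡ a
      left≡ = trans (cong₂ (λ j l → vtx j (proj₁ l)) copy≡ label≡) (ℕ.+-identityʳ a)
      right≡ : right e ≡ b
      right≡ = trans (cong₂ (λ j l → vtx j (proj₂ l)) copy≡ label≡) (ℕ.+-identityʳ b)

    neighbour⇒adjacent : ∀ {a b} (a<N : a ℕ.< order) (b<N : b ℕ.< order) → b ∈ neighbours edges a →
      Adjacent (first a<N) (first b<N)
    neighbour⇒adjacent a<N b<N b∈a with ∈-neighbours⁻ edges b∈a
    ... | inj₁ ab∈ = let e , eq = edge⇒adjacent a<N b<N ab∈ in e , inj₁ eq
    ... | inj₂ ba∈ = let e , eq = edge⇒adjacent b<N a<N ba∈ in e , inj₂ eq

    pentagonCycle : Cycle graph
    pentagonCycle = record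
      { last     = 4
      ; vertex   = λ i → first (pentagon<order i)
      ; distinct = λ {i} {j} eq → pentagon-injective i j
          (Fin.fromℕ<-injective (pentagon i) (pentagon j) _ _ eq)
      ; step     = λ i → neighbour⇒adjacent (pentagon<order (inject₁ i)) (pentagon<order (Fin.suc i)) (pentagon-step i)
      ; close    = neighbour⇒adjacent (pentagon<order (fromℕ 4)) (pentagon<order Fin.zero) pentagon-close
      ; 3≤length = s≤s (s≤s (s≤s z≤n))
      }

    girth : HasGirth graph 5
    girth = (pentagonCycle , refl) , 5≤length

-- A finite drawing with 63 vertices and 144 edges

-- Found by a computer search among point sets with (up to rounding) 7-fold
-- rotational symmetry, each orbit forming one of nine concentric heptagons.
-- The points are listed from left to right.
points : List Point
points =
  (-[1+ 1989 ] , -[1+ 203 ]) ∷ (-[1+ 1399 ] , + 1429) ∷ (-[1+ 1161 ] , + 506) ∷ (-[1+ 1119 ] , -[1+ 592 ]) ∷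
  (-[1+ 1080 ] , -[1+ 1682 ]) ∷ (-[1+ 550 ] , -[1+ 19 ]) ∷ (-[1+ 358 ] , + 419) ∷ (-[1+ 328 ] , + 1224) ∷
  (-[1+ 327 ] , -[1+ 442 ]) ∷ (-[1+ 271 ] , + 114) ∷ (-[1+ 258 ] , -[1+ 141 ]) ∷
  (-[1+ 233 ] , -[1+ 1244 ]) ∷ (-[1+ 164 ] , -[1+ 23 ]) ∷ (-[1+ 121 ] , + 114) ∷ (-[1+ 83 ] , -[1+ 143 ]) ∷
  (-[1+ 80 ] , + 284) ∷ (-[1+ 75 ] , -[1+ 10 ]) ∷ (-[1+ 54 ] , + 52) ∷ (-[1+ 49 ] , -[1+ 290 ]) ∷
  (-[1+ 44 ] , -[1+ 9 ]) ∷ (-[1+ 38 ] , -[1+ 65 ]) ∷ (-[1+ 35 ] , + 29) ∷ (-[1+ 22 ] , + 9) ∷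
  (-[1+ 21 ] , -[1+ 11 ]) ∷ (-[1+ 19 ] , -[1+ 40 ]) ∷ (-[1+ 10 ] , -[1+ 0 ]) ∷ (-[1+ 7 ] , + 8) ∷
  (-[1+ 6 ] , + 24) ∷ (-[1+ 5 ] , -[1+ 9 ]) ∷ (-[1+ 3 ] , -[1+ 24 ]) ∷ (+ 0 , + 46) ∷ (+ 1 , + 11) ∷
  (+ 4 , -[1+ 10 ]) ∷ (+ 6 , + 76) ∷ (+ 10 , + 6) ∷ (+ 11 , -[1+ 3 ]) ∷ (+ 13 , + 166) ∷ (+ 14 , + 20) ∷
  (+ 17 , -[1+ 17 ]) ∷ (+ 20 , -[1+ 40 ]) ∷ (+ 25 , + 2) ∷ (+ 27 , -[1+ 70 ]) ∷ (+ 36 , + 29) ∷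
  (+ 45 , -[1+ 9 ]) ∷ (+ 60 , -[1+ 154 ]) ∷ (+ 64 , + 42) ∷ (+ 73 , -[1+ 22 ]) ∷ (+ 104 , + 542) ∷
  (+ 138 , + 93) ∷ (+ 142 , -[1+ 532 ]) ∷ (+ 159 , -[1+ 49 ]) ∷ (+ 172 , + 240) ∷ (+ 196 , -[1+ 220 ]) ∷
  (+ 244 , + 1985) ∷ (+ 295 , + 15) ∷ (+ 488 , + 257) ∷ (+ 505 , -[1+ 221 ]) ∷ (+ 641 , -[1+ 1893 ]) ∷
  (+ 752 , + 1020) ∷ (+ 827 , -[1+ 959 ]) ∷ (+ 1266 , + 49) ∷ (+ 1704 , + 1047) ∷ (+ 1881 , -[1+ 679 ]) ∷ []

-- Only the values at 0, …, 62 matter; beyond them the origin is a junk value.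
position₆₃ : ℕ → Point
position₆₃ = go points
  where
  go : List Point → ℕ → Point
  go []       _       = ℤ.0ℤ , ℤ.0ℤ
  go (P ∷ _)  zero    = P
  go (_ ∷ Ps) (suc a) = go Ps a

edges₁₄₄ : List Label
edges₁₄₄ =
  (0 , 1) ∷ (0 , 4) ∷ (0 , 7) ∷ (0 , 11) ∷ (1 , 3) ∷ (1 , 53) ∷ (1 , 58) ∷ (2 , 4) ∷ (2 , 6) ∷ (2 , 8) ∷
  (2 , 9) ∷ (2 , 53) ∷ (3 , 5) ∷ (3 , 10) ∷ (3 , 49) ∷ (3 , 57) ∷ (4 , 57) ∷ (4 , 59) ∷ (5 , 7) ∷ (5 , 8) ∷
  (5 , 12) ∷ (6 , 7) ∷ (6 , 13) ∷ (6 , 58) ∷ (7 , 15) ∷ (7 , 61) ∷ (8 , 11) ∷ (8 , 14) ∷ (9 , 10) ∷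
  (9 , 15) ∷ (9 , 16) ∷ (9 , 36) ∷ (10 , 13) ∷ (10 , 18) ∷ (10 , 20) ∷ (11 , 18) ∷ (11 , 49) ∷ (11 , 56) ∷
  (11 , 62) ∷ (12 , 16) ∷ (12 , 18) ∷ (12 , 21) ∷ (12 , 24) ∷ (13 , 17) ∷ (13 , 19) ∷ (13 , 30) ∷
  (14 , 16) ∷ (14 , 20) ∷ (14 , 39) ∷ (14 , 52) ∷ (15 , 17) ∷ (15 , 48) ∷ (15 , 51) ∷ (16 , 19) ∷
  (16 , 22) ∷ (17 , 21) ∷ (17 , 27) ∷ (18 , 41) ∷ (18 , 52) ∷ (19 , 25) ∷ (19 , 26) ∷ (20 , 23) ∷
  (20 , 24) ∷ (20 , 44) ∷ (21 , 26) ∷ (21 , 31) ∷ (21 , 36) ∷ (22 , 23) ∷ (22 , 27) ∷ (22 , 31) ∷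
  (23 , 26) ∷ (23 , 29) ∷ (24 , 25) ∷ (24 , 28) ∷ (25 , 29) ∷ (25 , 31) ∷ (25 , 32) ∷ (26 , 28) ∷
  (26 , 34) ∷ (27 , 34) ∷ (27 , 37) ∷ (28 , 35) ∷ (28 , 38) ∷ (28 , 39) ∷ (29 , 38) ∷ (29 , 41) ∷
  (30 , 31) ∷ (30 , 33) ∷ (30 , 34) ∷ (30 , 48) ∷ (31 , 35) ∷ (32 , 34) ∷ (32 , 39) ∷ (32 , 40) ∷
  (32 , 43) ∷ (33 , 36) ∷ (33 , 37) ∷ (33 , 51) ∷ (34 , 42) ∷ (35 , 37) ∷ (35 , 42) ∷ (35 , 43) ∷
  (36 , 42) ∷ (36 , 47) ∷ (37 , 40) ∷ (38 , 40) ∷ (38 , 46) ∷ (39 , 41) ∷ (40 , 45) ∷ (41 , 44) ∷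
  (41 , 50) ∷ (42 , 45) ∷ (42 , 50) ∷ (43 , 44) ∷ (43 , 46) ∷ (44 , 49) ∷ (44 , 54) ∷ (45 , 48) ∷
  (45 , 54) ∷ (46 , 48) ∷ (46 , 50) ∷ (46 , 52) ∷ (47 , 58) ∷ (47 , 60) ∷ (48 , 55) ∷ (49 , 59) ∷
  (50 , 51) ∷ (50 , 56) ∷ (51 , 54) ∷ (51 , 58) ∷ (52 , 54) ∷ (52 , 59) ∷ (53 , 60) ∷ (53 , 61) ∷
  (54 , 60) ∷ (55 , 56) ∷ (55 , 58) ∷ (55 , 59) ∷ (56 , 60) ∷ (57 , 60) ∷ (57 , 62) ∷ (58 , 62) ∷
  (59 , 61) ∷ (61 , 62) ∷ []

pentagon₆₃ : Fin 5 → ℕ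
pentagon₆₃ = lookup (0 ∷ 1 ∷ 58 ∷ 6 ∷ 7 ∷ [])

block : Block
block = record
  { order              = 63
  ; position           = position₆₃
  -- The abscissae run from -1990 to 1881, an extent of 3871; any larger number serves.
  ; width              = 3900
  ; edges              = edges₁₄₄
  ; edges-unique       = from-yes (unique? edges₁₄₄)
  ; edges-ordered      = from-yes (All.all? (λ (a , b) → a ℕ.<? b ×-dec b ℕ.<? 63) edges₁₄₄)
  ; x-increasing       = from-yes (ℕ.allUpTo? (λ b → ℕ.allUpTo? (λ a → proj₁ (position₆₃ a) ℤ.<? proj₁ (position₆₃ b)) b) 63)
  ; x-spread           = from-yes (ℕ.allUpTo? (λ a → ℕ.allUpTo? (λ b →
      proj₁ (position₆₃ a) ℤ.<? proj₁ (position₆₃ b) ℤ.+ + 3900) 63) 63)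
  ; off-edges          = from-yes (All.all? (λ (a , b) → ℕ.allUpTo? (λ v →
      v ℕ.≤? a ⊎-dec ¬? (orient (position₆₃ a) (position₆₃ b) (position₆₃ v) ℤ.≟ ℤ.0ℤ)) b) edges₁₄₄)
  ; few-rivals         = from-yes (All.all? (λ e → length (rivals position₆₃ edges₁₄₄ e) ℕ.≤? 2 ×-dec
      All.all? (λ f → transversal? (segment position₆₃ e) (segment position₆₃ f)) (rivals position₆₃ edges₁₄₄ e)) edges₁₄₄)
  ; no-short-cycle     = from-yes (ℕ.allUpTo? (λ u → All.all? (λ v → All.all? (λ w → v ℕ.≟ w ⊎-dec
      (¬? (w ∈? neighbours edges₁₄₄ v) ×-dec
        All.all? (λ z → z ℕ.≟ u ⊎-dec ¬? (z ∈? neighbours edges₁₄₄ w)) (neighbours edges₁₄₄ v)))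
      (neighbours edges₁₄₄ u)) (neighbours edges₁₄₄ u)) 63)
  ; pentagon           = pentagon₆₃
  ; pentagon<order     = from-yes (Fin.all? λ i → pentagon₆₃ i ℕ.<? 63)
  ; pentagon-injective = from-yes (Fin.all? λ i → Fin.all? λ j → pentagon₆₃ i ℕ.≟ pentagon₆₃ j →-dec i Fin.≟ j)
  ; pentagon-step      = from-yes (Fin.all? λ i → pentagon₆₃ (Fin.suc i) ∈? neighbours edges₁₄₄ (pentagon₆₃ (inject₁ i)))
  ; pentagon-close     = from-yes (pentagon₆₃ Fin.zero ∈? neighbours edges₁₄₄ (pentagon₆₃ (fromℕ 4)))
  }

-- The number of edges

-- With `k` complete copies, `n` is at most 63 times `k + 1`, and each block of 63 vertices accounts
-- for exactly 144 edges. The subtracted 144 pays for the incomplete copy.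
sixteen-sevenths : ∀ n → (+ 2 / 1 + + 2 / 7) * (+ n / 1) - + 144 / 1 ≤ + (n ℕ./ 63 ℕ.* 144) / 1
sixteen-sevenths n = begin
  c * ι (+ n) - ι (+ 144)                            ≤⟨ ℚ.+-monoˡ-≤ (- ι (+ 144)) (ℚ.*-monoˡ-≤-nonNeg c (ι-mono-≤ (ℤ.+≤+ n≤))) ⟩
  c * ι (+ (63 ℕ.* suc k)) - ι (+ 144)               ≡⟨ cong (λ z → c * ι z - ι (+ 144)) (ℤ.pos-* 63 (suc k)) ⟩
  c * ι (+ 63 ℤ.* + suc k) - ι (+ 144)               ≡⟨ cong (λ z → c * z - ι (+ 144)) (ι-* (+ 63) (+ suc k)) ⟩
  c * (ι (+ 63) * ι (+ suc k)) - ι (+ 144)           ≡⟨ cong (_- ι (+ 144)) (sym (ℚ.*-assoc c (ι (+ 63)) (ι (+ suc k)))) ⟩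
  -- After reassociation the closed product of `c` and `ι (+ 63)` evaluates to `ι (+ 144)`.
  ι (+ 144) * ι (+ suc k) - ι (+ 144)                ≡⟨ cong (_- ι (+ 144)) (sym (ι-* (+ 144) (+ suc k))) ⟩
  ι (+ 144 ℤ.* + suc k) - ι (+ 144)                  ≡⟨ cong (λ z → ι z - ι (+ 144)) eq ⟩
  ι (+ (k ℕ.* 144) ℤ.+ + 144) - ι (+ 144)            ≡⟨ cong (_- ι (+ 144)) (ι-+ (+ (k ℕ.* 144)) (+ 144)) ⟩
  ι (+ (k ℕ.* 144)) + ι (+ 144) - ι (+ 144)          ≡⟨ solve 2 (λ x y → (x :+ y) :- y := x) refl (ι (+ (k ℕ.* 144))) (ι (+ 144)) ⟩
  ι (+ (k ℕ.* 144))                                  ∎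
  where
  open ℚ.≤-Reasoning
  open ℚ.+-*-Solver
  c = + 2 / 1 + + 2 / 7
  k = n ℕ./ 63
  n≤ : n ℕ.≤ 63 ℕ.* suc k
  n≤ = ℕ.≤-trans (ℕ.≤-reflexive (ℕ.m≡m%n+[m/n]*n n 63))
    (ℕ.≤-trans (ℕ.+-monoˡ-≤ (k ℕ.* 63) (ℕ.m%n≤n n 63)) (ℕ.≤-reflexive (ℕ.*-comm (suc k) 63)))
  eq : + 144 ℤ.* + suc k ≡ + (k ℕ.* 144) ℤ.+ + 144
  eq = trans (sym (ℤ.pos-* 144 (suc k))) (cong +_ (trans (ℕ.*-comm 144 (suc k)) (ℕ.+-comm 144 (k ℕ.* 144))))

theorem17 : ∃ λ (C : ℚ) → ∃ λ (n₀ : ℕ) → ∀ (n : ℕ) → n ≥ n₀ →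
    ∃ λ (G : Graph n) → KPlanar G 2 × HasGirth G 5 ×
    (+ 2 / 1 + + 2 / 7) * (+ n / 1) - C ≤ + Graph.size G / 1
-- The threshold provides one complete copy and with it a cycle of length five; the constant is the
-- number of edges of one block.
theorem17 = + 144 / 1 , 63 , λ n 63≤n →
  Copies.graph block n , Copies.planar block n , Copies.girth block n 63≤n , sixteen-sevenths n
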